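{- Let $p\in(0,1)$, $q=1-p$, and let $D\sim\mathcal D_p$. For any graph $G$ with $n$ nodes and average degree $d$ (an integer), the expected matching loss satisfies $$L(G)\ \ge\ \max\left\{npq^d-\frac12\left(1-(1-2p)^n\right),\ \ \frac12\,npq^d\left(1-(1-2p)^{n-d-1}\right)\right\}.$$
   Context: $G=([n],E)$ is a simple undirected graph with average degree $d=2|E|/n$. Under $\mathcal D_p$, the demands $D_j$, $j\in[n]$, are independent, each equal to $1/2$ with probability $p$ and $1$ with probability $q=1-p$. Let $\mathrm{supp}(D)=\{j:D_j=1/2\}$ and let $G[\mathrm{supp}(D)]$ be the subgraph induced by these nodes. For a graph $H$, $\mu(H)$ is its maximum matching size. With $K_n$ the complete graph on $[n]$, define $$L(G,D)=2\bigl(\mu(K_n[\mathrm{supp}(D)])-\mu(G[\mathrm{supp}(D)])\bigr),\qquad L(G)=\mathbb E_{D\sim\mathcal D_p}[L(G,D)].$$ The convention $0^0=1$ is used. -}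

module Defs where

open import Algebra.Apartness.Bundles using (HeytingField; HeytingCommutativeRing)
open import Algebra.Bundles using (CommutativeRing)
import Algebra.Properties.Semiring.Exp as Exp
import Algebra.Properties.Semiring.Mult as Mult
open import Data.Fin.Base as Fin using (Fin)
open import Data.Fin.Properties using (_≟_; _<?_)
open import Data.Fin.Subset using (Subset; Side; inside; outside; _∈_)
open import Data.Fin.Subset.Properties using (_∈?_)
open import Data.Integer.Base using (+_)
open import Data.List.Base using (List; []; _∷_; _++_; map; filter; length; foldr; allFin; cartesianProduct; cartesianProductWith)
open import Data.List.Extrema.Nat using (max)
open import Data.List.Relation.Unary.AllPairs using (AllPairs; allPairs?)
open import Data.Nat.Base as ℕ using (ℕ; zero; suc; NonZero)
open import Data.Product.Base using (_×_; _,_; proj₁; proj₂)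
open import Data.Rational.Unnormalised.Base as ℚᵘ using (ℚᵘ)
open import Data.Sum.Base using (_⊎_; inj₂)
open import Data.Vec.Base as Vec using (Vec; []; _∷_)
open import Function.Base using (_∘_)
open import Function.Bundles using (_⇔_; Equivalence)
open import Level using (Level; 0ℓ) renaming (suc to lsuc; _⊔_ to _⊔ˡ_)
open import Relation.Binary.Core using (Rel)
open import Relation.Binary.Definitions using (Symmetric; Irreflexive; Decidable)
open import Relation.Binary.Lattice.Structures using (IsLattice)
open import Relation.Binary.PropositionalEquality.Core using (_≡_; _≢_)
import Relation.Binary.PropositionalEquality.Core as ≡
open import Relation.Binary.Structures using (IsStrictPartialOrder)
open import Relation.Nullary.Decidable using (¬?; _×-dec_)
open import Relation.Nullary.Negation using (¬_)

-- The library has no real numbers, so scalars range over an arbitrary ordered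
-- field.  The axioms are the constructive ones: the apartness and the lattice
-- structure replace decidability and totality of the order, which the
-- constructive reals lack.  For a decidable order they amount to the usual
-- axioms of a totally ordered field, with _⊔_ the usual maximum.
record OrderedField c ℓ₁ ℓ₂ ℓ₃ : Set (lsuc (c ⊔ˡ ℓ₁ ⊔ˡ ℓ₂ ⊔ˡ ℓ₃)) where
  infix  4 _<_ _≤_ _≥_
  infixl 6 _⊔_
  infixl 7 _⊓_
  field
    heytingField : HeytingField c ℓ₁ ℓ₂

  open HeytingField heytingField public

  field
    _<_                  : Rel Carrier ℓ₃
    _≤_                  : Rel Carrier ℓ₃
    _⊔_                  : Carrier → Carrier → Carrier
    _⊓_                  : Carrier → Carrier → Carrier
    isStrictPartialOrder : IsStrictPartialOrder _≈_ _<_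
    isLattice            : IsLattice _≈_ _≤_ _⊔_ _⊓_
    #⇔<⊎>                : ∀ {x y} → x # y ⇔ (x < y ⊎ y < x)
    ≤⇔≯                  : ∀ {x y} → x ≤ y ⇔ (¬ (y < x))
    0<1                  : 0# < 1#
    +-monoˡ-<            : ∀ z {x y} → x < y → x + z < y + z
    *-pos                : ∀ {x y} → 0# < x → 0# < y → 0# < x * y

  _≥_ : Rel Carrier ℓ₃
  x ≥ y = y ≤ x

  commutativeRing : CommutativeRing c ℓ₁
  commutativeRing = HeytingCommutativeRing.commutativeRing heytingCommutativeRing

  open CommutativeRing commutativeRing public using (semiring)

  open Exp semiring public using (_^_)
  open Mult semiring public renaming (_×_ to _·_) using ()

  fromℕ : ℕ → Carrier
  fromℕ k = k · 1#

  private
    module SPO = IsStrictPartialOrder isStrictPartialOrder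

  2#0 : (1# + 1#) # 0#
  2#0 = Equivalence.from #⇔<⊎> (inj₂ (SPO.trans 0<1 (SPO.<-respˡ-≈ (+-identityˡ 1#) (+-monoˡ-< 1# 0<1))))

  ½ : Carrier
  ½ = proj₁ (#⇒invertible 2#0)

  ½*[2-0]≈1 : ½ * ((1# + 1#) - 0#) ≈ 1#
  ½*[2-0]≈1 = proj₁ (proj₂ (#⇒invertible 2#0))

record SimpleGraph (n : ℕ) : Set₁ where
  field
    Adj    : Rel (Fin n) 0ℓ
    adj?   : Decidable Adj
    sym    : Symmetric Adj
    irrefl : Irreflexive _≡_ Adj

open SimpleGraph

complete : ∀ n → SimpleGraph n
complete n = record
  { Adj    = _≢_
  ; adj?   = λ i j → ¬? (i ≟ j)
  ; sym    = ≡.≢-sym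
  ; irrefl = λ i≡j i≢j → i≢j i≡j
  }

-- Nodes outside S are kept as isolated nodes rather than deleted; the edge set,
-- and hence the set of matchings, is that of the induced subgraph.
induced : ∀ {n} → SimpleGraph n → Subset n → SimpleGraph n
induced G S = record
  { Adj    = λ i j → Adj G i j × i ∈ S × j ∈ S
  ; adj?   = λ i j → adj? G i j ×-dec (i ∈? S) ×-dec (j ∈? S)
  ; sym    = λ (a , i∈S , j∈S) → sym G a , j∈S , i∈S
  ; irrefl = λ i≡j (a , _) → irrefl G i≡j a
  }

-- An undirected edge {i , j} is represented once, by the pair with i < j.
Edge : ℕ → Set
Edge n = Fin n × Fin n

edges : ∀ {n} → SimpleGraph n → List (Edge n)
edges {n} G = filter (λ (i , j) → (i <? j) ×-dec adj? G i j) (cartesianProduct (allFin n) (allFin n))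

averageDegree : ∀ {n} .{{_ : NonZero n}} → SimpleGraph n → ℚᵘ
averageDegree {n} G = (+ (2 ℕ.* length (edges G))) ℚᵘ./ n

Disjoint : ∀ {n} → Rel (Edge n) 0ℓ
Disjoint (i , j) (k , l) = (i ≢ k × i ≢ l) × (j ≢ k × j ≢ l)

disjoint? : ∀ {n} → Decidable (Disjoint {n})
disjoint? (i , j) (k , l) =
  (¬? (i ≟ k) ×-dec ¬? (i ≟ l)) ×-dec (¬? (j ≟ k) ×-dec ¬? (j ≟ l))

sublists : ∀ {a} {A : Set a} → List A → List (List A)
sublists []       = [] ∷ []
sublists (x ∷ xs) = map (x ∷_) (sublists xs) ++ sublists xs

matchings : ∀ {n} → SimpleGraph n → List (List (Edge n))
matchings G = filter (allPairs? disjoint?) (sublists (edges G))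

-- The default value 0 is attained by the empty matching.
μ : ∀ {n} → SimpleGraph n → ℕ
μ G = max 0 (map length (matchings G))

-- half and full stand for the demand values 1/2 and 1.
data Demand : Set where
  half full : Demand

supp : ∀ {n} → Vec Demand n → Subset n
supp = Vec.map isHalf
  where
  isHalf : Demand → Side
  isHalf half = inside
  isHalf full = outside

outcomes : ∀ n → List (Vec Demand n)
outcomes zero    = [] ∷ []
outcomes (suc n) = cartesianProductWith _∷_ (half ∷ full ∷ []) (outcomes n)

module _ {c ℓ₁ ℓ₂ ℓ₃} (F : OrderedField c ℓ₁ ℓ₂ ℓ₃) where
  open OrderedField F

  Pr₁ : Carrier → Demand → Carrier
  Pr₁ p half = p
  Pr₁ p full = 1# - p

  -- Independence: the joint probability is the product of the marginals.
  Pr : Carrier → ∀ {n} → Vec Demand n → Carrier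
  Pr p D = Vec.foldr′ _*_ 1# (Vec.map (Pr₁ p) D)

  𝔼 : Carrier → ∀ {n} → (Vec Demand n → Carrier) → Carrier
  𝔼 p {n} X = foldr _+_ 0# (map (λ D → Pr p D * X D) (outcomes n))

  matchingLoss : ∀ {n} → SimpleGraph n → Vec Demand n → Carrier
  matchingLoss {n} G D =
    fromℕ 2 * (fromℕ (μ (induced (complete n) (supp D))) - fromℕ (μ (induced G (supp D))))

  expectedMatchingLoss : Carrier → ∀ {n} → SimpleGraph n → Carrier
  expectedMatchingLoss p G = 𝔼 p (matchingLoss G)

-- Let S = supp D, and let I be the number of isolated vertices of G[S].  A
-- matching of G[S] avoids them, so 2 μ(G[S]) + I ≤ |S|, whereas
-- 2 μ(K_n[S]) ≥ |S| - [|S| odd].  Hence L(G,D) ≥ I - [|S| odd] and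
-- L(G,D) ≥ I · [|S| even].  Writing the parity of |S| through (-1)^|S|, every
-- expectation becomes one of a product of independent factors: with r = 1 - 2p
-- and e the degree of i, vertex i contributes p q^e to E[I] and
-- p q^e (1 - r^(n-e-1)) / 2 to E[I · [|S| even]].  Both are convex in e, and the
-- degrees have mean d, so Jensen's inequality concludes.
module Submission where

open import Algebra.Bundles using (CommutativeRing; Monoid)
import Algebra.Properties.CommutativeMonoid.Sum
import Algebra.Properties.Monoid.Mult
import Algebra.Properties.Monoid.Sum
import Algebra.Properties.Semiring.Exp
import Algebra.Properties.Semiring.Mult
import Algebra.Properties.Semiring.Sum
import Algebra.Solver.Ring
open import Algebra.Solver.Ring.AlmostCommutativeRing using (fromCommutativeRing; _-Raw-AlmostCommutative⟶_; Induced-equivalence)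
open import Data.Bool.Base using (true; false; if_then_else_)
open import Data.Fin.Base as Fin using (Fin; zero; suc)
open import Data.Fin.Properties as Fin using (_≟_; _<?_; all?)
open import Data.Fin.Subset using (_∈_)
open import Data.Integer.Base as ℤ using (ℤ; +_; -[1+_]; +[1+_]; _⊖_)
import Data.Integer.Properties as ℤ
open import Data.List.Base using (List; []; _∷_; _++_; map; filter; length; foldr; tabulate; allFin; cartesianProduct)
open import Data.List.Extrema.Nat using (argmax-all; xs≤max)
import Data.List.Membership.Propositional as L
open import Data.List.Membership.Propositional.Properties
open import Data.List.Properties using (length-++; length-map; length-tabulate; filter-++; ++-identityʳ)
open import Data.List.Relation.Binary.Subset.Propositional using (_⊆_)
open import Data.List.Relation.Unary.All as All using (All; []; _∷_)
import Data.List.Relation.Unary.All.Properties as All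
open import Data.List.Relation.Unary.AllPairs as AllPairs using (AllPairs; []; _∷_; allPairs?)
import Data.List.Relation.Unary.AllPairs.Properties as AllPairs
open import Data.List.Relation.Unary.Any using (here; there)
open import Data.List.Relation.Unary.Unique.Propositional using (Unique)
import Data.List.Relation.Unary.Unique.Propositional.Properties as Unique
open import Data.Maybe.Base as Maybe using ()
open import Data.Nat.Base as ℕ using (ℕ; zero; suc; NonZero; _∸_; z≤n; s≤s; parity)
open import Data.Nat.ListAction using (sum)
import Data.Nat.Properties as ℕ
open import Data.Parity.Base using (0ℙ; 1ℙ)
open import Data.Product.Base using (_×_; _,_; ∃; proj₁; proj₂; swap)
open import Data.Product.Properties using (≡-dec)
open import Data.Rational.Unnormalised.Base using (_≃_; _/_; *≡*)
open import Data.Sum.Base using (inj₁; inj₂)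
open import Data.Vec.Base using (Vec; []; _∷_; here; there; lookup)
open import Function.Base using (_∘_; case_of_; id)
open import Function.Bundles using (module Equivalence)
open import Relation.Binary.Bundles using (Poset)
open import Relation.Binary.Consequences using (dec⇒weaklyDec)
open import Relation.Binary.Definitions using (WeaklyDecidable; tri<; tri≈; tri>)
open import Relation.Binary.Lattice.Structures using (module IsLattice)
open import Relation.Binary.PropositionalEquality as ≡ using (_≡_; _≢_)
import Relation.Binary.Reasoning.PartialOrder
import Relation.Binary.Reasoning.Setoid
open import Relation.Binary.Structures using (module IsStrictPartialOrder)
open import Relation.Nullary.Decidable using (Dec; does; yes; no; ¬?; _×-dec_; _→-dec_)
open import Relation.Nullary.Negation using (¬_; contradiction)
open import Relation.Unary using (Pred; Decidable)

open import Defs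

-- Isolation of `i` is a conjunction over `j` of conditions on the single demand of `j`. Its
-- indicator times v^|S| is therefore a product of independent factors for every scalar `v`, and one
-- computation, `E-isolated-χ`, yields both expectations, at v = 1 and at v = -1. The order on
-- scalars is not assumed total, so Jensen's inequality takes a discrete form: a function on ℕ with
-- increasing forward differences, a supporting line at the natural number `d`, and a case split
-- that compares natural numbers only.

module Graph = SimpleGraph

-- Counting, sublists and pairwise relations on lists.

module _ {a} {A : Set a} where

  -- Each head of `xs` is cut out of `ys` at one of its occurrences; uniqueness keeps the tail of
  -- `xs` inside what remains. Inclusions between finite vertex or edge sets become cardinality
  -- bounds through this lemma.
  Unique-⊆⇒length≤ : ∀ {xs ys : List A} → Unique xs → xs ⊆ ys → length xs ℕ.≤ length ys
  Unique-⊆⇒length≤ [] _ = z≤n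
  Unique-⊆⇒length≤ {x ∷ xs} (x∉xs ∷ xs!) xs⊆ys with ∈-∃++ (xs⊆ys (here ≡.refl))
  ... | as , bs , ≡.refl = ≡.subst (suc (length xs) ℕ.≤_) (≡.sym length-split)
    (s≤s (ℕ.≤-trans (Unique-⊆⇒length≤ xs! xs⊆as++bs) (ℕ.≤-reflexive (length-++ as))))
    where
    length-split : length (as ++ x ∷ bs) ≡ suc (length as ℕ.+ length bs)
    length-split = ≡.trans (length-++ as) (ℕ.+-suc _ _)
    xs⊆as++bs : xs ⊆ as ++ bs
    xs⊆as++bs z∈xs with ∈-++⁻ as (xs⊆ys (there z∈xs))
    ... | inj₁ z∈as          = ∈-++⁺ˡ z∈as
    ... | inj₂ (here ≡.refl) = contradiction ≡.refl (All.lookup x∉xs z∈xs)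
    ... | inj₂ (there z∈bs)  = ∈-++⁺ʳ as z∈bs

  filter∈sublists : ∀ {p} {P : Pred A p} (P? : Decidable P) xs → filter P? xs L.∈ sublists xs
  filter∈sublists P? []       = here ≡.refl
  filter∈sublists P? (x ∷ xs) with does (P? x)
  ... | true  = ∈-++⁺ˡ (∈-map⁺ (x ∷_) (filter∈sublists P? xs))
  ... | false = ∈-++⁺ʳ (map (x ∷_) (sublists xs)) (filter∈sublists P? xs)

  ∈sublists⇒⊆ : ∀ {ys : List A} (xs : List A) → ys L.∈ sublists xs → ys ⊆ xs
  ∈sublists⇒⊆ []       (here ≡.refl) ()
  ∈sublists⇒⊆ (x ∷ xs) ys∈ y∈ys with ∈-++⁻ (map (x ∷_) (sublists xs)) ys∈
  ... | inj₂ ys∈ʳ = there (∈sublists⇒⊆ xs ys∈ʳ y∈ys)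
  ... | inj₁ ys∈ˡ with ∈-map⁻ (x ∷_) ys∈ˡ
  ...   | zs , zs∈ , ≡.refl with y∈ys
  ...     | here y≡x   = here y≡x
  ...     | there y∈zs = there (∈sublists⇒⊆ xs zs∈ y∈zs)

  -- For a symmetric relation and distinct entries, `AllPairs` does not depend on the order of the
  -- list. With the converse `apart⇒AllPairs`, this carries disjointness of a matching over to a
  -- reordering of it.
  AllPairs⇒apart : ∀ {r} {R : A → A → Set r} → (∀ {x y} → R x y → R y x) →
    ∀ {xs} → AllPairs R xs → ∀ {x y} → x L.∈ xs → y L.∈ xs → x ≢ y → R x y
  AllPairs⇒apart R-sym (_ ∷ _)   (here ≡.refl) (here ≡.refl) x≢y = contradiction ≡.refl x≢y
  AllPairs⇒apart R-sym (Rx ∷ _)  (here ≡.refl) (there y∈)    _   = All.lookup Rx y∈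
  AllPairs⇒apart R-sym (Ry ∷ _)  (there x∈)    (here ≡.refl) _   = R-sym (All.lookup Ry x∈)
  AllPairs⇒apart R-sym (_ ∷ Rxs) (there x∈)    (there y∈)    x≢y = AllPairs⇒apart R-sym Rxs x∈ y∈ x≢y

  apart⇒AllPairs : ∀ {r} {R : A → A → Set r} {xs} → Unique xs →
    (∀ {x y} → x L.∈ xs → y L.∈ xs → x ≢ y → R x y) → AllPairs R xs
  apart⇒AllPairs []           _ = []
  apart⇒AllPairs (x∉xs ∷ xs!) R =
    All.tabulate (λ y∈ → R (here ≡.refl) (there y∈) (All.lookup x∉xs y∈)) ∷
    apart⇒AllPairs xs! (λ x∈ y∈ → R (there x∈) (there y∈))

-- Matchings

pairs! : ∀ n → Unique (cartesianProduct (allFin n) (allFin n))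
pairs! n = Unique.cartesianProduct⁺ (Unique.allFin⁺ n) (Unique.allFin⁺ n)

module _ {n} (G : SimpleGraph n) where

  EdgeOf : Edge n → Set
  EdgeOf (i , j) = i Fin.< j × Graph.Adj G i j

  edgeOf? : Decidable EdgeOf
  edgeOf? (i , j) = (i <? j) ×-dec Graph.adj? G i j

  ∈edges⁺ : ∀ {e} → EdgeOf e → e L.∈ edges G
  ∈edges⁺ {i , j} = ∈-filter⁺ edgeOf? (∈-cartesianProduct⁺ (∈-allFin i) (∈-allFin j))

  ∈edges⁻ : ∀ {e} → e L.∈ edges G → EdgeOf e
  ∈edges⁻ = proj₂ ∘ ∈-filter⁻ edgeOf? {xs = cartesianProduct (allFin n) (allFin n)}

  edges! : Unique (edges G)
  edges! = Unique.filter⁺ edgeOf? (pairs! n)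

  Disjoint-sym : ∀ {e f : Edge n} → Disjoint e f → Disjoint f e
  Disjoint-sym ((a , b) , (c , d)) = ((a ∘ ≡.sym , c ∘ ≡.sym) , (b ∘ ≡.sym , d ∘ ≡.sym))

  -- M may list its edges in any order, whereas matchings G only contains
  -- sublists of edges G; filter (_∈? M) (edges G) puts M in that order.
  length≤μ : ∀ {M} → AllPairs Disjoint M → All EdgeOf M → length M ℕ.≤ μ G
  length≤μ {M} disj M⊆E = ℕ.≤-trans
    (Unique-⊆⇒length≤ M! (λ e∈M → ∈-filter⁺ (_∈? M) (∈edges⁺ (All.lookup M⊆E e∈M)) e∈M))
    (All.lookup (xs≤max 0 (map length (matchings G))) (∈-map⁺ length (∈-filter⁺ (allPairs? disjoint?)
      (filter∈sublists (_∈? M) (edges G))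
      (apart⇒AllPairs (Unique.filter⁺ (_∈? M) edges!) (λ x∈ y∈ → AllPairs⇒apart Disjoint-sym disj (inM x∈) (inM y∈))))))
    where
    open import Data.List.Membership.DecPropositional (≡-dec _≟_ (_≟_ {n})) using (_∈?_)
    M! : Unique M
    M! = AllPairs.map (λ { ((i≢i , _) , _) ≡.refl → i≢i ≡.refl }) disj
    inM : ∀ {e} → e L.∈ filter (_∈? M) (edges G) → e L.∈ M
    inM = proj₂ ∘ ∈-filter⁻ (_∈? M) {xs = edges G}

  -- The maximum is either its default 0 or attained by an enumerated matching. All later reasoning
  -- about `μ` goes through this principle and `length≤μ`, never through the enumeration.
  μ-elim : ∀ {p} {P : Pred ℕ p} → P 0 → (∀ {M} → AllPairs Disjoint M → All EdgeOf M → P (length M)) → P (μ G)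
  μ-elim {P = P} P0 PM = argmax-all id {P = P} P0 (All.map⁺ (All.tabulate (λ M∈ →
    let M∈sub , disj = ∈-filter⁻ (allPairs? disjoint?) {xs = sublists (edges G)} M∈
    in  PM disj (All.tabulate (λ e∈ → ∈edges⁻ (∈sublists⇒⊆ (edges G) M∈sub e∈))))))

  degree : Fin n → ℕ
  degree i = length (filter (Graph.adj? G i) (allFin n))

-- Degree sums and the handshake lemma.

length-filter-cartesianProduct : ∀ {a b p} {A : Set a} {B : Set b} {P : A × B → Set p} (P? : Decidable P) xs ys →
  length (filter P? (cartesianProduct xs ys)) ≡ sum (map (λ x → length (filter (λ y → P? (x , y)) ys)) xs)
length-filter-cartesianProduct P? []       ys = ≡.refl
length-filter-cartesianProduct P? (x ∷ xs) ys = begin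
  length (filter P? (map (x ,_) ys ++ rest))                   ≡⟨ ≡.cong length (filter-++ P? (map (x ,_) ys) rest) ⟩
  length (filter P? (map (x ,_) ys) ++ filter P? rest)         ≡⟨ length-++ (filter P? (map (x ,_) ys)) ⟩
  length (filter P? (map (x ,_) ys)) ℕ.+ length (filter P? rest) ≡⟨ ≡.cong₂ ℕ._+_ (row ys) (length-filter-cartesianProduct P? xs ys) ⟩
  _ ∎
  where
  open ≡.≡-Reasoning
  rest = cartesianProduct xs ys
  row : ∀ ys → length (filter P? (map (x ,_) ys)) ≡ length (filter (λ y → P? (x , y)) ys)
  row [] = ≡.refl
  row (y ∷ ys) with does (P? (x , y))
  ... | true  = ≡.cong suc (row ys)
  ... | false = row ys

module _ {n} (G : SimpleGraph n) where

  -- The ordered adjacent pairs are counted twice: by rows they give the degree sum, and they also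
  -- consist of the edges and their swaps, two lists without a common entry because edges are stored
  -- with the smaller node first.
  handshake : sum (map (degree G) (allFin n)) ≡ 2 ℕ.* length (edges G)
  handshake = begin
    sum (map (degree G) (allFin n))   ≡⟨ length-filter-cartesianProduct adj?′ (allFin n) (allFin n) ⟨
    length arcs                       ≡⟨ ℕ.≤-antisym (Unique-⊆⇒length≤ (Unique.filter⁺ adj?′ (pairs! n)) arcs⊆) (Unique-⊆⇒length≤ both! ⊆arcs) ⟩
    length (edges G ++ map swap (edges G)) ≡⟨ length-++ (edges G) ⟩
    length (edges G) ℕ.+ length (map swap (edges G)) ≡⟨ ≡.cong (length (edges G) ℕ.+_) (≡.trans (length-map swap (edges G)) (≡.sym (ℕ.+-identityʳ _))) ⟩
    2 ℕ.* length (edges G) ∎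
    where
    open ≡.≡-Reasoning
    adj?′ : Decidable (λ (e : Edge n) → Graph.Adj G (proj₁ e) (proj₂ e))
    adj?′ (i , j) = Graph.adj? G i j
    arcs = filter adj?′ (cartesianProduct (allFin n) (allFin n))
    ∈arcs⁺ : ∀ {i j} → Graph.Adj G i j → (i , j) L.∈ arcs
    ∈arcs⁺ {i} {j} = ∈-filter⁺ adj?′ (∈-cartesianProduct⁺ (∈-allFin i) (∈-allFin j))
    both! : Unique (edges G ++ map swap (edges G))
    both! = Unique.++⁺ (edges! G) (Unique.map⁺ (λ { ≡.refl → ≡.refl }) (edges! G)) λ (e∈ , e∈ʳ) → clash e∈ (∈-map⁻ swap e∈ʳ)
      where
      clash : ∀ {e} → e L.∈ edges G → ∃ (λ f → f L.∈ edges G × e ≡ swap f) → _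
      clash e∈ (f , f∈ , ≡.refl) = Fin.<-asym (proj₁ (∈edges⁻ G e∈)) (proj₁ (∈edges⁻ G f∈))
    ⊆arcs : edges G ++ map swap (edges G) ⊆ arcs
    ⊆arcs e∈ with ∈-++⁻ (edges G) e∈
    ... | inj₁ e∈ˡ = ∈arcs⁺ (proj₂ (∈edges⁻ G e∈ˡ))
    ... | inj₂ e∈ʳ with ∈-map⁻ swap e∈ʳ
    ...   | f , f∈ , ≡.refl = ∈arcs⁺ (Graph.sym G (proj₂ (∈edges⁻ G f∈)))
    arcs⊆ : arcs ⊆ edges G ++ map swap (edges G)
    arcs⊆ {i , j} e∈ with proj₂ (∈-filter⁻ adj?′ {xs = cartesianProduct (allFin n) (allFin n)} e∈) | Fin.<-cmp i j
    ... | ij | tri< i<j _ _ = ∈-++⁺ˡ (∈edges⁺ G (i<j , ij))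
    ... | ij | tri≈ _ i≡j _ = contradiction ij (Graph.irrefl G i≡j)
    ... | ij | tri> _ _ j<i = ∈-++⁺ʳ (edges G) (∈-map⁺ swap (∈edges⁺ G (j<i , Graph.sym G ij)))

-- Matching `n` as a successor lets the fraction compute, so that `eq` is the cross-multiplied
-- equation in `ℤ`; both sides are images of natural numbers.
∑-degree : ∀ {n} .{{_ : NonZero n}} (G : SimpleGraph n) d → averageDegree G ≃ (+ d) / 1 →
  sum (map (degree G) (allFin n)) ≡ n ℕ.* d
∑-degree {n@(suc _)} G d (*≡* eq) = begin
  sum (map (degree G) (allFin n))  ≡⟨ handshake G ⟩
  2 ℕ.* length (edges G)           ≡⟨ ℕ.*-identityʳ _ ⟨
  2 ℕ.* length (edges G) ℕ.* 1     ≡⟨ ℤ.+-injective (≡.trans (ℤ.pos-* (2 ℕ.* length (edges G)) 1) (≡.trans eq (≡.sym (ℤ.pos-* d n)))) ⟩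
  d ℕ.* n                          ≡⟨ ℕ.*-comm d n ⟩
  n ℕ.* d                          ∎
  where open ≡.≡-Reasoning

-- The support of a demand vector

half? : Decidable (_≡ half)
half? half = yes ≡.refl
half? full = no λ ()

∈supp⁺ : ∀ {n} (D : Vec Demand n) {j} → lookup D j ≡ half → j ∈ supp D
∈supp⁺ (half ∷ D) {zero}  ≡.refl = here
∈supp⁺ (_ ∷ D)    {suc j} Dj   = there (∈supp⁺ D Dj)

∈supp⁻ : ∀ {n} (D : Vec Demand n) {j} → j ∈ supp D → lookup D j ≡ half
∈supp⁻ (half ∷ D) {zero}  here       = ≡.refl
∈supp⁻ (_ ∷ D)    {suc j} (there j∈) = ∈supp⁻ D j∈

halves : ∀ {n} → Vec Demand n → List (Fin n)
halves {n} D = filter (λ j → half? (lookup D j)) (allFin n)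

-- On `halves D` this is a matching of the complete graph on the support that misses at most one
-- vertex. That list is increasing, so each pair already has the orientation required of an edge.
pairUp : ∀ {n} → List (Fin n) → List (Edge n)
pairUp (i ∷ j ∷ is) = (i , j) ∷ pairUp is
pairUp _            = []

module _ {n : ℕ} where

  pairUp⁺ : ∀ {p} {P : Pred (Fin n) p} {is} → All P is → All (λ (k , l) → P k × P l) (pairUp is)
  pairUp⁺ []             = []
  pairUp⁺ (_ ∷ [])       = []
  pairUp⁺ (pi ∷ pj ∷ ps) = (pi , pj) ∷ pairUp⁺ ps

  pairUp-< : ∀ {is : List (Fin n)} → AllPairs Fin._<_ is → All (λ (k , l) → k Fin.< l) (pairUp is)
  pairUp-< []                      = []
  pairUp-< (_ ∷ [])                = []
  pairUp-< ((i<j ∷ _) ∷ (_ ∷ is<)) = i<j ∷ pairUp-< is<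

  pairUp-Disjoint : ∀ {is : List (Fin n)} → Unique is → AllPairs Disjoint (pairUp is)
  pairUp-Disjoint []                          = []
  pairUp-Disjoint (_ ∷ [])                    = []
  pairUp-Disjoint ((_ ∷ i∉is) ∷ (j∉is ∷ is!)) =
    All.zip (pairUp⁺ i∉is , pairUp⁺ j∉is) ∷ pairUp-Disjoint is!

  length-pairUp-even : ∀ (is : List (Fin n)) → parity (length is) ≡ 0ℙ →
    length is ≡ length (pairUp is) ℕ.+ length (pairUp is)
  length-pairUp-even []           _  = ≡.refl
  length-pairUp-even (_ ∷ [])     ()
  length-pairUp-even (_ ∷ _ ∷ is) ev = ≡.cong suc (≡.trans (≡.cong suc (length-pairUp-even is ev)) (≡.sym (ℕ.+-suc _ _)))

  length-pairUp-odd : ∀ (is : List (Fin n)) → parity (length is) ≡ 1ℙ →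
    length is ≡ suc (length (pairUp is) ℕ.+ length (pairUp is))
  length-pairUp-odd []           ()
  length-pairUp-odd (_ ∷ [])     _  = ≡.refl
  length-pairUp-odd (_ ∷ _ ∷ is) od = ≡.cong suc (≡.cong suc (≡.trans (length-pairUp-odd is od) (≡.sym (ℕ.+-suc _ _))))

  endpoints : List (Edge n) → List (Fin n)
  endpoints []            = []
  endpoints ((i , j) ∷ M) = i ∷ j ∷ endpoints M

  length-endpoints : ∀ M → length (endpoints M) ≡ length M ℕ.+ length M
  length-endpoints []      = ≡.refl
  length-endpoints (_ ∷ M) = ≡.cong suc (≡.trans (≡.cong suc (length-endpoints M)) (≡.sym (ℕ.+-suc _ _)))

  endpoints⁺ : ∀ {p} {P : Pred (Fin n) p} {M} → All (λ (i , j) → P i × P j) M → All P (endpoints M)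
  endpoints⁺ []               = []
  endpoints⁺ ((pi , pj) ∷ ps) = pi ∷ pj ∷ endpoints⁺ ps

  endpoints! : ∀ {M} → AllPairs Disjoint M → All (λ (i , j) → i ≢ j) M → Unique (endpoints M)
  endpoints! []           []         = []
  endpoints! (disj ∷ M!) (i≢j ∷ M≢) =
    (i≢j ∷ endpoints⁺ (All.map proj₁ disj)) ∷ endpoints⁺ (All.map proj₂ disj) ∷ endpoints! M! M≢

-- Isolated vertices and the loss of a single outcome.

module _ {n} (G : SimpleGraph n) where

  -- Isolation is encoded as one condition per vertex `j`, on the demand of `j` alone, so that its
  -- indicator factorises over independent demands. The case `i ≡ j` puts `i` itself into the
  -- support: vertices outside it do not count as isolated.
  Compatible : Fin n → Fin n → Demand → Set
  Compatible i j δ = (i ≡ j → δ ≡ half) × (Graph.Adj G i j → δ ≡ full)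

  full? : Decidable (_≡ full)
  full? half = no λ ()
  full? full = yes ≡.refl

  compatible? : ∀ i j → Decidable (Compatible i j)
  compatible? i j δ = ((i ≟ j) →-dec half? δ) ×-dec (Graph.adj? G i j →-dec full? δ)

  Isolated : Vec Demand n → Fin n → Set
  Isolated D i = ∀ j → Compatible i j (lookup D j)

  isolated? : ∀ D → Decidable (Isolated D)
  isolated? D i = all? (λ j → compatible? i j (lookup D j))

  isolated : Vec Demand n → List (Fin n)
  isolated D = filter (isolated? D) (allFin n)

module _ {n} (G : SimpleGraph n) (D : Vec Demand n) where

  private
    K[S] = induced (complete n) (supp D)
    G[S] = induced G (supp D)
    2μK  = μ K[S] ℕ.+ μ K[S]
    2μG  = μ G[S] ℕ.+ μ G[S]
    s    = length (halves D)

  pairUp≤μK : length (pairUp (halves D)) ℕ.≤ μ K[S]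
  pairUp≤μK = length≤μ K[S] (pairUp-Disjoint (Unique.filter⁺ _ (Unique.allFin⁺ n)))
    (All.zipWith (λ (k<l , k∈ , l∈) → k<l , Fin.<⇒≢ k<l , k∈ , l∈)
      (pairUp-< (AllPairs.filter⁺ _ (AllPairs.tabulate⁺-< id)) , pairUp⁺ (All.map (∈supp⁺ D) (All.all-filter _ (allFin n)))))

  2μG+isolated≤halves : 2μG ℕ.+ length (isolated G D) ℕ.≤ s
  2μG+isolated≤halves = μ-elim G[S] {P = λ m → (m ℕ.+ m) ℕ.+ length (isolated G D) ℕ.≤ s} I≤s bound
    where
    ∈halves : ∀ {i} → lookup D i ≡ half → i L.∈ halves D
    ∈halves {i} = ∈-filter⁺ (λ j → half? (lookup D j)) (∈-allFin i)
    ∈isolated⁻ : ∀ {i} → i L.∈ isolated G D → Isolated G D i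
    ∈isolated⁻ = proj₂ ∘ ∈-filter⁻ (isolated? G D) {xs = allFin n}
    isolated⊆halves : isolated G D ⊆ halves D
    isolated⊆halves i∈ = ∈halves (proj₁ (∈isolated⁻ i∈ _) ≡.refl)
    isolated! : Unique (isolated G D)
    isolated! = Unique.filter⁺ (isolated? G D) (Unique.allFin⁺ n)
    I≤s : length (isolated G D) ℕ.≤ s
    I≤s = Unique-⊆⇒length≤ isolated! isolated⊆halves
    bound : ∀ {M} → AllPairs Disjoint M → All (EdgeOf G[S]) M → (length M ℕ.+ length M) ℕ.+ length (isolated G D) ℕ.≤ s
    bound {M} disj M⊆E = ≡.subst (ℕ._≤ s) (≡.trans (length-++ (endpoints M)) (≡.cong (ℕ._+ _) (length-endpoints M)))
      (Unique-⊆⇒length≤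
        (Unique.++⁺ (endpoints! disj (All.map (Fin.<⇒≢ ∘ proj₁) M⊆E)) isolated!
          (λ (i∈M , i∈I) → proj₂ (All.lookup touched i∈M) (∈isolated⁻ i∈I)))
        ⊆halves)
      where
      touched : All (λ i → lookup D i ≡ half × ¬ Isolated G D i) (endpoints M)
      touched = endpoints⁺ (All.map (λ { {i , j} (_ , ij , i∈ , j∈) →
          (∈supp⁻ D i∈ , busy ij j∈) , (∈supp⁻ D j∈ , busy (Graph.sym G ij) i∈) }) M⊆E)
        where
        -- The partner `j` of a matched vertex has demand `half`, whereas isolation of `i` would
        -- force `full` on it.
        busy : ∀ {i j} → Graph.Adj G i j → j ∈ supp D → ¬ Isolated G D i
        busy {j = j} ij j∈ iso with () ← ≡.trans (≡.sym (∈supp⁻ D j∈)) (proj₂ (iso j) ij)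
      ⊆halves : endpoints M ++ isolated G D ⊆ halves D
      ⊆halves i∈ with ∈-++⁻ (endpoints M) i∈
      ... | inj₁ i∈M = ∈halves (proj₁ (All.lookup touched i∈M))
      ... | inj₂ i∈I = isolated⊆halves i∈I

  halves≤2μK-even : parity s ≡ 0ℙ → s ℕ.≤ 2μK
  halves≤2μK-even ev = begin
    s                                                          ≡⟨ length-pairUp-even (halves D) ev ⟩
    length (pairUp (halves D)) ℕ.+ length (pairUp (halves D))  ≤⟨ ℕ.+-mono-≤ pairUp≤μK pairUp≤μK ⟩
    2μK                                                        ∎
    where open ℕ.≤-Reasoning

  isolated-gap-even : parity s ≡ 0ℙ → 2μG ℕ.+ length (isolated G D) ℕ.≤ 2μK
  isolated-gap-even ev = ℕ.≤-trans 2μG+isolated≤halves (halves≤2μK-even ev)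

  halves≤1+2μK-odd : parity s ≡ 1ℙ → s ℕ.≤ suc 2μK
  halves≤1+2μK-odd od = begin
    s                                                                ≡⟨ length-pairUp-odd (halves D) od ⟩
    suc (length (pairUp (halves D)) ℕ.+ length (pairUp (halves D)))  ≤⟨ s≤s (ℕ.+-mono-≤ pairUp≤μK pairUp≤μK) ⟩
    suc 2μK                                                          ∎
    where open ℕ.≤-Reasoning

  isolated-gap-odd : parity s ≡ 1ℙ → 2μG ℕ.+ length (isolated G D) ℕ.≤ suc 2μK
  isolated-gap-odd od = ℕ.≤-trans 2μG+isolated≤halves (halves≤1+2μK-odd od)

  halves≤1+2μK : s ℕ.≤ suc 2μK
  halves≤1+2μK with parity s in eq
  ... | 0ℙ = ℕ.m≤n⇒m≤1+n (halves≤2μK-even eq)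
  ... | 1ℙ = halves≤1+2μK-odd eq

  -- This makes the loss nonnegative, which the second bound needs when |S| is odd. It follows from
  -- 2μG ≤ |S| ≤ 2μK + 1: if `μ G[S]` exceeded `μ K[S]`, then 2μG would be at least 2μK + 2.
  μ-gap : 2μG ℕ.≤ 2μK
  μ-gap = ℕ.+-mono-≤ μG≤μK μG≤μK
    where
    μG≤μK : μ G[S] ℕ.≤ μ K[S]
    μG≤μK = ℕ.≮⇒≥ λ K<G → ℕ.<-irrefl ≡.refl (begin-strict
      suc 2μK                        <⟨ ℕ.≤-reflexive (≡.cong suc (≡.sym (ℕ.+-suc _ _))) ⟩
      suc (μ K[S]) ℕ.+ suc (μ K[S])  ≤⟨ ℕ.+-mono-≤ K<G K<G ⟩
      2μG                            ≤⟨ ℕ.m+n≤o⇒m≤o 2μG 2μG+isolated≤halves ⟩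
      s                              ≤⟨ halves≤1+2μK ⟩
      suc 2μK                        ∎)
      where open ℕ.≤-Reasoning

-- A ring solver with integer coefficients.

module IntegerCoefficients {c ℓ} (R : CommutativeRing c ℓ) where
  open CommutativeRing R
  open import Algebra.Properties.Semiring.Mult.TCOptimised semiring using (×1-homo-*; ×-homo-+; 1+×) renaming (_×_ to _·_)
  open import Algebra.Properties.Ring ring using (-‿distribˡ-*; -‿distribʳ-*; -0#≈0#; -‿involutive)
  open import Algebra.Properties.AbelianGroup +-abelianGroup using (⁻¹-∙-comm)
  open import Algebra.Properties.CommutativeSemigroup +-commutativeSemigroup using (interchange)
  open import Relation.Binary.Reasoning.Setoid setoid

  -- The canonical homomorphism from `ℤ`: coefficients are compared in `ℤ`, where equality is
  -- decidable, instead of in the ring. The optimised multiple makes `1 · 1#` compute to `1#`, so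
  -- the constant `:1` denotes `1#` itself.
  ⟦_⟧ : ℤ → Carrier
  ⟦ + n ⟧      = n · 1#
  ⟦ -[1+ n ] ⟧ = - (suc n · 1#)

  -‿homo : ∀ i → ⟦ ℤ.- i ⟧ ≈ - ⟦ i ⟧
  -‿homo (+ 0)     = sym -0#≈0#
  -‿homo +[1+ n ]  = refl
  -‿homo -[1+ n ]  = sym (-‿involutive _)

  ⊖-homo : ∀ m n → ⟦ m ⊖ n ⟧ ≈ m · 1# - n · 1#
  ⊖-homo m       zero    = sym (trans (+-congˡ -0#≈0#) (+-identityʳ _))
  ⊖-homo zero    (suc n) = sym (+-identityˡ _)
  ⊖-homo (suc m) (suc n) = begin
    ⟦ suc m ⊖ suc n ⟧                    ≡⟨ ≡.cong ⟦_⟧ (ℤ.[1+m]⊖[1+n]≡m⊖n m n) ⟩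
    ⟦ m ⊖ n ⟧                            ≈⟨ ⊖-homo m n ⟩
    m · 1# - n · 1#                      ≈⟨ +-identityˡ _ ⟨
    0# + (m · 1# - n · 1#)               ≈⟨ +-congʳ (-‿inverseʳ 1#) ⟨
    (1# - 1#) + (m · 1# - n · 1#)        ≈⟨ interchange 1# (- 1#) (m · 1#) (- (n · 1#)) ⟩
    (1# + m · 1#) + (- 1# - n · 1#)      ≈⟨ +-congˡ (⁻¹-∙-comm 1# (n · 1#)) ⟩
    (1# + m · 1#) - (1# + n · 1#)        ≈⟨ +-cong (1+× m 1#) (-‿cong (1+× n 1#)) ⟨
    suc m · 1# - suc n · 1#              ∎

  +-homo : ∀ i j → ⟦ i ℤ.+ j ⟧ ≈ ⟦ i ⟧ + ⟦ j ⟧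
  +-homo (+ m)     (+ n)     = ×-homo-+ 1# m n
  +-homo (+ m)     -[1+ n ]  = ⊖-homo m (suc n)
  +-homo -[1+ m ]  (+ n)     = trans (⊖-homo n (suc m)) (+-comm _ _)
  +-homo -[1+ m ]  -[1+ n ]  = begin
    - (suc (suc (m ℕ.+ n)) · 1#)           ≡⟨ ≡.cong (λ k → - (k · 1#)) (≡.cong suc (ℕ.+-suc m n)) ⟨
    - ((suc m ℕ.+ suc n) · 1#)             ≈⟨ -‿cong (×-homo-+ 1# (suc m) (suc n)) ⟩
    - (suc m · 1# + suc n · 1#)            ≈⟨ ⁻¹-∙-comm _ _ ⟨
    - (suc m · 1#) - suc n · 1#            ∎

  *-homo⁺ : ∀ m j → ⟦ + m ℤ.* j ⟧ ≈ m · 1# * ⟦ j ⟧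
  *-homo⁺ m (+ n) = begin
    ⟦ + m ℤ.* + n ⟧      ≡⟨ ≡.cong ⟦_⟧ (ℤ.pos-* m n) ⟨
    (m ℕ.* n) · 1#       ≈⟨ ×1-homo-* m n ⟩
    m · 1# * n · 1#      ∎
  *-homo⁺ m -[1+ n ] = begin
    ⟦ + m ℤ.* ℤ.- + suc n ⟧    ≡⟨ ≡.cong ⟦_⟧ (ℤ.neg-distribʳ-* (+ m) (+ suc n)) ⟨
    ⟦ ℤ.- (+ m ℤ.* + suc n) ⟧  ≈⟨ -‿homo (+ m ℤ.* + suc n) ⟩
    - ⟦ + m ℤ.* + suc n ⟧      ≈⟨ -‿cong (*-homo⁺ m (+ suc n)) ⟩
    - (m · 1# * suc n · 1#)    ≈⟨ -‿distribʳ-* _ _ ⟩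
    m · 1# * - (suc n · 1#)    ∎

  *-homo : ∀ i j → ⟦ i ℤ.* j ⟧ ≈ ⟦ i ⟧ * ⟦ j ⟧
  *-homo (+ m)    j = *-homo⁺ m j
  *-homo -[1+ m ] j = begin
    ⟦ ℤ.- + suc m ℤ.* j ⟧      ≡⟨ ≡.cong ⟦_⟧ (ℤ.neg-distribˡ-* (+ suc m) j) ⟨
    ⟦ ℤ.- (+ suc m ℤ.* j) ⟧    ≈⟨ -‿homo (+ suc m ℤ.* j) ⟩
    - ⟦ + suc m ℤ.* j ⟧        ≈⟨ -‿cong (*-homo⁺ (suc m) j) ⟩
    - (suc m · 1# * ⟦ j ⟧)     ≈⟨ -‿distribˡ-* _ _ ⟩
    - (suc m · 1#) * ⟦ j ⟧     ∎

  morphism : ℤ.+-*-rawRing -Raw-AlmostCommutative⟶ fromCommutativeRing R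
  morphism = record
    { ⟦_⟧ = ⟦_⟧ ; +-homo = +-homo ; *-homo = *-homo ; -‿homo = -‿homo ; 0-homo = refl ; 1-homo = refl }

  _coeff≟_ : WeaklyDecidable (Induced-equivalence morphism)
  i coeff≟ j = Maybe.map (λ i≡j → reflexive (≡.cong ⟦_⟧ i≡j)) (dec⇒weaklyDec ℤ._≟_ i j)

module RingSolver {c ℓ} (R : CommutativeRing c ℓ) where
  open IntegerCoefficients R
  open Algebra.Solver.Ring ℤ.+-*-rawRing (fromCommutativeRing R) morphism _coeff≟_ public

  :0 :1 :2 : ∀ {n} → Polynomial n
  :0 = con (+ 0)
  :1 = con (+ 1)
  -- The reification of fromℕ 2, which unfolds to 1# + (1# + 0#).
  :2 = :1 :+ (:1 :+ :0)

module _ {a ℓ} (M : Monoid a ℓ) where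
  open Monoid M
  open Algebra.Properties.Monoid.Sum M renaming (sum to ⨁)
  open Algebra.Properties.Monoid.Mult M renaming (_×_ to _·_)

  -- Stated for a monoid so as to serve twice: additively it counts the entries satisfying `P`,
  -- multiplicatively it collects equal factors into a power.
  sum-if : ∀ {b p} {B : Set b} {P : Pred B p} (P? : Decidable P) x {n} (f : Fin n → B) →
    ⨁ (λ i → if does (P? (f i)) then x else ε) ≈ length (filter P? (tabulate f)) · x
  sum-if P? x {zero}  f = refl
  sum-if P? x {suc n} f with does (P? (f zero))
  ... | true  = ∙-congˡ (sum-if P? x (f ∘ suc))
  ... | false = trans (identityˡ _) (sum-if P? x (f ∘ suc))

-- Inequalities in an ordered field, and discrete convexity.

module OrderedFieldProperties {c ℓ₁ ℓ₂ ℓ₃} (F : OrderedField c ℓ₁ ℓ₂ ℓ₃) where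
  open OrderedField F hiding (zero)
  open RingSolver commutativeRing using (solve; _:+_; _:*_; _:-_; _:=_; :0; :1)
  open Algebra.Properties.Semiring.Sum semiring using () renaming (sum to ∑)
  open Algebra.Properties.Semiring.Mult semiring using (×-homo-+; ×1-homo-*)

  private
    module < = IsStrictPartialOrder isStrictPartialOrder
    module ≤ = IsLattice isLattice
    poset : Poset c ℓ₁ ℓ₃
    poset = record { isPartialOrder = ≤.isPartialOrder }

  module ≤-Reasoning = Relation.Binary.Reasoning.PartialOrder poset
  module ≈-Reasoning = Relation.Binary.Reasoning.Setoid setoid

  ≮⇒≥ : ∀ {x y} → ¬ (y < x) → x ≤ y
  ≮⇒≥ = Equivalence.from ≤⇔≯

  ≤⇒≯ : ∀ {x y} → x ≤ y → ¬ (y < x)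
  ≤⇒≯ = Equivalence.to ≤⇔≯

  <⇒≤ : ∀ {x y} → x < y → x ≤ y
  <⇒≤ x<y = ≮⇒≥ (<.asym x<y)

  -- As `x ≤ y` means that `y < x` fails, a strict violation of the shifted inequality is shifted
  -- back by `- z` and contradicts the hypothesis.
  +-monoˡ-≤ : ∀ z {x y} → x ≤ y → x + z ≤ y + z
  +-monoˡ-≤ z {x} {y} x≤y = ≮⇒≥ λ y+z<x+z →
    ≤⇒≯ x≤y (<.<-respʳ-≈ (cancel x) (<.<-respˡ-≈ (cancel y) (+-monoˡ-< (- z) y+z<x+z)))
    where
    cancel : ∀ w → (w + z) - z ≈ w
    cancel w = solve 2 (λ w z → (w :+ z) :- z := w) refl w z

  +-mono-≤ : ∀ {x y u v} → x ≤ y → u ≤ v → x + u ≤ y + v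
  +-mono-≤ {x} {y} {u} {v} x≤y u≤v = begin
    x + u  ≤⟨ +-monoˡ-≤ u x≤y ⟩
    y + u  ≈⟨ +-comm y u ⟩
    u + y  ≤⟨ +-monoˡ-≤ y u≤v ⟩
    v + y  ≈⟨ +-comm v y ⟩
    y + v  ∎
    where open ≤-Reasoning

  0≤y-x⇒x≤y : ∀ {x y} → 0# ≤ y - x → x ≤ y
  0≤y-x⇒x≤y {x} {y} 0≤y-x = begin
    x            ≈⟨ +-identityˡ x ⟨
    0# + x       ≤⟨ +-monoˡ-≤ x 0≤y-x ⟩
    (y - x) + x  ≈⟨ solve 2 (λ x y → (y :- x) :+ x := y) refl x y ⟩
    y            ∎
    where open ≤-Reasoning

  x≤y⇒0≤y-x : ∀ {x y} → x ≤ y → 0# ≤ y - x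
  x≤y⇒0≤y-x {x} {y} x≤y = begin
    0#     ≈⟨ -‿inverseʳ x ⟨
    x - x  ≤⟨ +-monoˡ-≤ (- x) x≤y ⟩
    y - x  ∎
    where open ≤-Reasoning

  +-nonneg : ∀ {x y} → 0# ≤ x → 0# ≤ y → 0# ≤ x + y
  +-nonneg 0≤x 0≤y = ≤.trans (≤.reflexive (sym (+-identityˡ 0#))) (+-mono-≤ 0≤x 0≤y)

  -- Without totality of the order: a nonnegative element that is not positive
  -- vanishes by tightness of the apartness.
  *-nonneg : ∀ {x y} → 0# ≤ x → 0# ≤ y → 0# ≤ x * y
  *-nonneg {x} {y} 0≤x 0≤y = ≮⇒≥ λ xy<0 →
    let
      x≯0 : ¬ (0# < x)
      x≯0 0<x = <.irrefl (trans (*-congˡ (vanish 0≤y (λ 0<y → <.asym xy<0 (*-pos 0<x 0<y)))) (zeroʳ x)) xy<0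
    in <.irrefl (trans (*-congʳ (vanish 0≤x x≯0)) (zeroˡ y)) xy<0
    where
    vanish : ∀ {z} → 0# ≤ z → ¬ (0# < z) → z ≈ 0#
    vanish {z} 0≤z z≯0 = proj₁ (tight z 0#) λ z#0 → case Equivalence.to #⇔<⊎> z#0 of λ where
      (inj₁ z<0) → ≤⇒≯ 0≤z z<0
      (inj₂ 0<z) → z≯0 0<z

  *-monoʳ-≤ : ∀ {z x y} → 0# ≤ z → x ≤ y → z * x ≤ z * y
  *-monoʳ-≤ {z} {x} {y} 0≤z x≤y = 0≤y-x⇒x≤y (≤.trans (*-nonneg 0≤z (x≤y⇒0≤y-x x≤y))
    (≤.reflexive (solve 3 (λ x y z → z :* (y :- x) := z :* y :- z :* x) refl x y z)))

  ^-nonneg : ∀ {x} → 0# ≤ x → ∀ k → 0# ≤ x ^ k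
  ^-nonneg 0≤x zero    = <⇒≤ 0<1
  ^-nonneg 0≤x (suc k) = *-nonneg 0≤x (^-nonneg 0≤x k)

  fromℕ-nonneg : ∀ k → 0# ≤ fromℕ k
  fromℕ-nonneg zero    = ≤.refl
  fromℕ-nonneg (suc k) = +-nonneg (<⇒≤ 0<1) (fromℕ-nonneg k)

  fromℕ-mono-≤ : ∀ {j k} → j ℕ.≤ k → fromℕ j ≤ fromℕ k
  fromℕ-mono-≤ {k = k} z≤n = fromℕ-nonneg k
  fromℕ-mono-≤ (s≤s j≤k)   = +-mono-≤ ≤.refl (fromℕ-mono-≤ j≤k)

  ½+½≈1 : ½ + ½ ≈ 1#
  ½+½≈1 = trans (solve 1 (λ h → h :+ h := h :* ((:1 :+ :1) :- :0)) refl ½) ½*[2-0]≈1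

  0≤½ : 0# ≤ ½
  0≤½ = ≮⇒≥ λ ½<0 → <.asym 0<1 (<.<-respˡ-≈ ½+½≈1
    (<.trans (+-monoˡ-< ½ ½<0) (<.<-respˡ-≈ (sym (+-identityˡ ½)) ½<0)))

  ∑-mono-≤ : ∀ {n} {f g : Fin n → Carrier} → (∀ i → f i ≤ g i) → ∑ f ≤ ∑ g
  ∑-mono-≤ {zero}  f≤g = ≤.refl
  ∑-mono-≤ {suc n} f≤g = +-mono-≤ (f≤g zero) (∑-mono-≤ (f≤g ∘ suc))

  fromℕ-sum : ∀ {b} {B : Set b} (h : B → ℕ) {n} (f : Fin n → B) →
    fromℕ (sum (map h (tabulate f))) ≈ ∑ (λ i → fromℕ (h (f i)))
  fromℕ-sum h {zero}  f = refl
  fromℕ-sum h {suc n} f = trans (×-homo-+ 1# (h (f zero)) _) (+-congˡ (fromℕ-sum h (f ∘ suc)))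

  -- Discrete convexity

  Convex : (ℕ → Carrier) → Set ℓ₃
  Convex f = ∀ k → f (1 ℕ.+ k) + f (1 ℕ.+ k) ≤ f k + f (2 ℕ.+ k)

  Δ : (ℕ → Carrier) → ℕ → Carrier
  Δ f k = f (suc k) - f k

  module _ {f : ℕ → Carrier} (convex : Convex f) where

    Δ-step : ∀ k → Δ f k ≤ Δ f (suc k)
    Δ-step k = 0≤y-x⇒x≤y (≤.trans (x≤y⇒0≤y-x (convex k)) (≤.reflexive
      (solve 3 (λ a b c → (a :+ c) :- (b :+ b) := (c :- b) :- (b :- a)) refl (f k) (f (suc k)) (f (2 ℕ.+ k)))))

    -- The increments of `f` from `x` to `m + x` telescope, and by convexity each is at least the
    -- first one.
    chord-≥ : ∀ {δ} x m → δ ≤ Δ f x → f x + fromℕ m * δ ≤ f (m ℕ.+ x)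
    chord-≥ {δ} x zero    _    = ≤.reflexive (solve 2 (λ a δ → a :+ :0 :* δ := a) refl (f x) δ)
    chord-≥ {δ} x (suc m) δ≤Δx = begin
      f x + (1# + fromℕ m) * δ     ≈⟨ solve 3 (λ a m δ → a :+ (:1 :+ m) :* δ := (a :+ m :* δ) :+ δ) refl (f x) (fromℕ m) δ ⟩
      (f x + fromℕ m * δ) + δ      ≤⟨ +-mono-≤ (chord-≥ x m δ≤Δx) (≤.trans δ≤Δx (Δ-mono m)) ⟩
      f (m ℕ.+ x) + Δ f (m ℕ.+ x)  ≈⟨ solve 2 (λ a b → a :+ (b :- a) := b) refl (f (m ℕ.+ x)) (f (suc m ℕ.+ x)) ⟩
      f (suc m ℕ.+ x)              ∎
      where
      open ≤-Reasoning
      Δ-mono : ∀ m → Δ f x ≤ Δ f (m ℕ.+ x)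
      Δ-mono zero    = ≤.refl
      Δ-mono (suc m) = ≤.trans (Δ-mono m) (Δ-step (m ℕ.+ x))

    -- The mirror image of `chord-≥`. The hypothesis concerns the increment starting at the right
    -- end `m + x`, one past the last increment summed, because `tangent` applies it with `m + x`
    -- equal to `d` and slope `Δ f d`.
    chord-≤ : ∀ {δ} x m → Δ f (m ℕ.+ x) ≤ δ → f (m ℕ.+ x) ≤ f x + fromℕ m * δ
    chord-≤ {δ} x zero    _    = ≤.reflexive (solve 2 (λ a δ → a := a :+ :0 :* δ) refl (f x) δ)
    chord-≤ {δ} x (suc m) Δ≤δ  = begin
      f (suc m ℕ.+ x)              ≈⟨ solve 2 (λ a b → b := a :+ (b :- a)) refl (f (m ℕ.+ x)) (f (suc m ℕ.+ x)) ⟩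
      f (m ℕ.+ x) + Δ f (m ℕ.+ x)  ≤⟨ +-mono-≤ (chord-≤ x m Δm≤δ) Δm≤δ ⟩
      (f x + fromℕ m * δ) + δ      ≈⟨ solve 3 (λ a m δ → (a :+ m :* δ) :+ δ := a :+ (:1 :+ m) :* δ) refl (f x) (fromℕ m) δ ⟩
      f x + (1# + fromℕ m) * δ     ∎
      where
      open ≤-Reasoning
      Δm≤δ : Δ f (m ℕ.+ x) ≤ δ
      Δm≤δ = ≤.trans (Δ-step (m ℕ.+ x)) Δ≤δ

    -- The line through the value at `d` with the forward difference there as slope supports `f`:
    -- increments from `d` on are at least that slope, earlier ones at most.
    tangent : ∀ d x → f d + (fromℕ x - fromℕ d) * Δ f d ≤ f x
    tangent d x with ℕ.≤-total d x
    ... | inj₁ d≤x with ℕ.m≤n⇒∃[o]m+o≡n d≤x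
    ...   | m , ≡.refl rewrite ℕ.+-comm d m = begin
      f d + (fromℕ (m ℕ.+ d) - fromℕ d) * δ        ≈⟨ +-congˡ (*-congʳ (+-congʳ (×-homo-+ 1# m d))) ⟩
      f d + ((fromℕ m + fromℕ d) - fromℕ d) * δ    ≈⟨ solve 4 (λ a m d δ → a :+ ((m :+ d) :- d) :* δ := a :+ m :* δ) refl (f d) (fromℕ m) (fromℕ d) δ ⟩
      f d + fromℕ m * δ                            ≤⟨ chord-≥ d m ≤.refl ⟩
      f (m ℕ.+ d)                                  ∎
      where
      open ≤-Reasoning
      δ = Δ f d
    tangent d x | inj₂ x≤d with ℕ.m≤n⇒∃[o]m+o≡n x≤d
    ...   | m , ≡.refl rewrite ℕ.+-comm x m = begin
      f (m ℕ.+ x) + (fromℕ x - fromℕ (m ℕ.+ x)) * δ      ≤⟨ +-mono-≤ (chord-≤ x m ≤.refl) (≤.reflexive (*-congʳ (+-congˡ (-‿cong (×-homo-+ 1# m x))))) ⟩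
      (f x + fromℕ m * δ) + (fromℕ x - (fromℕ m + fromℕ x)) * δ ≈⟨ solve 4 (λ a m x δ → (a :+ m :* δ) :+ (x :- (m :+ x)) :* δ := a) refl (f x) (fromℕ m) (fromℕ x) δ ⟩
      f x ∎
      where
      open ≤-Reasoning
      δ = Δ f (m ℕ.+ x)

    -- The supporting lines at `d` are summed over all `x i`; since `d` is their mean, the linear
    -- terms cancel.
    jensen : ∀ {n} d (x : Fin n → ℕ) → ∑ (λ i → fromℕ (x i)) ≈ fromℕ (n ℕ.* d) → fromℕ n * f d ≤ ∑ (λ i → f (x i))
    jensen {n} d x mean = begin
      -- The zero multiple of `δ` is inserted so that `mean` can turn its first product into the sum
      -- of the `x i`.
      fromℕ n * f d                                                         ≈⟨ solve 4 (λ n a D δ → n :* a := n :* a :+ (n :* D :- n :* D) :* δ) refl (fromℕ n) (f d) (fromℕ d) δ ⟩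
      fromℕ n * f d + (fromℕ n * fromℕ d - fromℕ n * fromℕ d) * δ           ≈⟨ +-congˡ (*-congʳ (+-congʳ (trans mean (×1-homo-* n d)))) ⟨
      fromℕ n * f d + (∑ (λ i → fromℕ (x i)) - fromℕ n * fromℕ d) * δ       ≈⟨ ∑-affine x ⟨
      ∑ (λ i → f d + (fromℕ (x i) - fromℕ d) * δ)                           ≤⟨ ∑-mono-≤ (λ i → tangent d (x i)) ⟩
      ∑ (λ i → f (x i))                                                     ∎
      where
      open ≤-Reasoning
      δ = Δ f d
      ∑-affine : ∀ {n} (x : Fin n → ℕ) → ∑ (λ i → f d + (fromℕ (x i) - fromℕ d) * δ) ≈
        fromℕ n * f d + (∑ (λ i → fromℕ (x i)) - fromℕ n * fromℕ d) * δ
      ∑-affine {zero}  x = solve 3 (λ a d δ → :0 := :0 :* a :+ (:0 :- :0 :* d) :* δ) refl (f d) (fromℕ d) δ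
      ∑-affine {suc n} x = trans (+-congˡ (∑-affine (x ∘ suc)))
        (solve 6 (λ a x₀ d δ n X → (a :+ (x₀ :- d) :* δ) :+ (n :* a :+ (X :- n :* d) :* δ) :=
            (:1 :+ n) :* a :+ ((x₀ :+ X) :- (:1 :+ n) :* d) :* δ) refl
          (f d) (fromℕ (x zero)) (fromℕ d) δ (fromℕ n) (∑ (λ i → fromℕ (x (suc i)))))

-- The vertices outside a closed neighbourhood.

module _ {n} (G : SimpleGraph n) where

  -- These are the vertices whose demand is left free by isolation of `i`.
  Remote : Fin n → Fin n → Set
  Remote i j = i ≢ j × ¬ Graph.Adj G i j

  remote? : ∀ i → Decidable (Remote i)
  remote? i j = ¬? (i ≟ j) ×-dec ¬? (Graph.adj? G i j)

  length-self : ∀ i → length (filter (i ≟_) (allFin n)) ≡ 1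
  length-self i = ℕ.≤-antisym
    (Unique-⊆⇒length≤ {ys = i ∷ []} (Unique.filter⁺ (i ≟_) (Unique.allFin⁺ n)) (λ j∈ → here (≡.sym (proj₂ (∈-filter⁻ (i ≟_) {xs = allFin n} j∈)))))
    (Unique-⊆⇒length≤ ([] ∷ []) (λ { (here ≡.refl) → ∈-filter⁺ (i ≟_) (∈-allFin i) ≡.refl }))

  -- The vertex `i`, its neighbours and the remote vertices partition the vertex set; by `total` the
  -- truncated subtractions are therefore exact.
  length-remote : ∀ i → length (filter (remote? i) (allFin n)) ≡ n ∸ degree G i ∸ 1
  length-remote i = begin
    c                                            ≡⟨ ℕ.m+n∸m≡n (degree G i ℕ.+ 1) c ⟨
    degree G i ℕ.+ 1 ℕ.+ c ∸ (degree G i ℕ.+ 1)  ≡⟨ ≡.cong (_∸ (degree G i ℕ.+ 1)) total ⟩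
    n ∸ (degree G i ℕ.+ 1)                       ≡⟨ ℕ.∸-+-assoc n (degree G i) 1 ⟨
    n ∸ degree G i ∸ 1                           ∎
    where
    open ≡.≡-Reasoning
    c = length (filter (remote? i) (allFin n))
    split : ∀ js → length (filter (Graph.adj? G i) js) ℕ.+ length (filter (i ≟_) js) ℕ.+ length (filter (remote? i) js) ≡ length js
    split [] = ≡.refl
    split (j ∷ js) with Graph.adj? G i j | i ≟ j
    ... | yes ij | yes i≡j = contradiction ij (Graph.irrefl G i≡j)
    ... | yes ij | no  i≢j = ≡.cong suc (split js)
    ... | no ¬ij | yes i≡j = ≡.trans (≡.cong (ℕ._+ length (filter (remote? i) js)) (ℕ.+-suc (length (filter (Graph.adj? G i) js)) _)) (≡.cong suc (split js))
    ... | no ¬ij | no  i≢j = ≡.trans (ℕ.+-suc _ _) (≡.cong suc (split js))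
    total : degree G i ℕ.+ 1 ℕ.+ c ≡ n
    total = ≡.trans (≡.cong (λ k → degree G i ℕ.+ k ℕ.+ c) (≡.sym (length-self i)))
      (≡.trans (split (allFin n)) (length-tabulate id))

-- Expectations over the demands and the two lower bounds.

module ExpectedLoss {c ℓ₁ ℓ₂ ℓ₃} (F : OrderedField c ℓ₁ ℓ₂ ℓ₃) where
  open OrderedField F hiding (zero)
  open CommutativeRing commutativeRing using (*-commutativeMonoid; +-monoid; *-monoid)
  open RingSolver commutativeRing using (solve; _:+_; _:*_; _:-_; :-_; _:=_; :0; :1; :2)
  open Algebra.Properties.Semiring.Sum semiring using (*-distribʳ-sum; ∑-distrib-+; sum-cong-≋) renaming (sum to ∑)
  open Algebra.Properties.CommutativeMonoid.Sum *-commutativeMonoid using () renaming (sum to ∏; ∑-distrib-+ to ∏-distrib-*; sum-cong-≋ to ∏-cong)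
  open OrderedFieldProperties F
  open Algebra.Properties.Semiring.Mult semiring using (×-homo-+)
  open Algebra.Properties.Semiring.Exp semiring using (^-congˡ)
  private module ≤ = IsLattice isLattice

  𝟙 : ∀ {a} {A : Set a} → Dec A → Carrier
  𝟙 A? = if does A? then 1# else 0#

  -- The decision `Q?` is arbitrary, tied to the conjunction only by the two implications, so the
  -- induction can pass to the tail with the same `Q?`.
  ∏-𝟙 : ∀ {p q n} {P : Fin n → Set p} {Q : Set q} (P? : ∀ j → Dec (P j)) (Q? : Dec Q) →
    (Q → ∀ j → P j) → ((∀ j → P j) → Q) → ∏ (λ j → 𝟙 (P? j)) ≈ 𝟙 Q?
  ∏-𝟙 {n = zero}  P? (yes _) _   _   = refl
  ∏-𝟙 {n = zero}  P? (no ¬Q) _   ∀P⇒Q = contradiction (∀P⇒Q λ ()) ¬Q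
  ∏-𝟙 {n = suc n} P? Q? Q⇒∀P ∀P⇒Q with P? zero
  ... | yes P₀ = trans (*-identityˡ _)
    (∏-𝟙 (P? ∘ suc) Q? (λ Q → Q⇒∀P Q ∘ suc) (λ Pₛ → ∀P⇒Q λ { zero → P₀ ; (suc j) → Pₛ j }))
  ... | no ¬P₀ with Q?
  ...   | yes Q = contradiction (Q⇒∀P Q zero) ¬P₀
  ...   | no _  = zeroˡ _

  1^ : ∀ k → 1# ^ k ≈ 1#
  1^ zero    = refl
  1^ (suc k) = trans (*-identityˡ _) (1^ k)

  private
    -1*-1* : ∀ x → - 1# * (- 1# * x) ≈ x
    -1*-1* = solve 1 (λ x → (:- :1) :* ((:- :1) :* x) := x) refl

  -1^even : ∀ k → parity k ≡ 0ℙ → (- 1#) ^ k ≈ 1#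
  -1^even zero          _  = refl
  -1^even (suc (suc k)) ev = trans (-1*-1* _) (-1^even k ev)

  -1^odd : ∀ k → parity k ≡ 1ℙ → (- 1#) ^ k ≈ - 1#
  -1^odd (suc zero)    _  = *-identityʳ _
  -1^odd (suc (suc k)) od = trans (-1*-1* _) (-1^odd k od)

  module _ (p : Carrier) (0<p : 0# < p) (p<1 : p < 1#) where

    q r : Carrier
    q = 1# - p
    r = 1# - fromℕ 2 * p

    0≤p : 0# ≤ p
    0≤p = <⇒≤ 0<p

    0≤q : 0# ≤ q
    0≤q = x≤y⇒0≤y-x (<⇒≤ p<1)

    -- The recursion step splits r = q - p and uses p + q = 1.
    1±r^k-nonneg : ∀ k → 0# ≤ 1# - r ^ k × 0# ≤ 1# + r ^ k
    1±r^k-nonneg zero    = x≤y⇒0≤y-x ≤.refl , +-nonneg (<⇒≤ 0<1) (<⇒≤ 0<1)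
    1±r^k-nonneg (suc k) with 1±r^k-nonneg k
    ... | 0≤1-R , 0≤1+R =
      ≤.trans (+-nonneg (*-nonneg 0≤q 0≤1-R) (*-nonneg 0≤p 0≤1+R)) (≤.reflexive
        (solve 2 (λ p R → (:1 :- p) :* (:1 :- R) :+ p :* (:1 :+ R) :=
          :1 :- (:1 :- :2 :* p) :* R) refl p (r ^ k))) ,
      ≤.trans (+-nonneg (*-nonneg 0≤q 0≤1+R) (*-nonneg 0≤p 0≤1-R)) (≤.reflexive
        (solve 2 (λ p R → (:1 :- p) :* (:1 :+ R) :+ p :* (:1 :- R) :=
          :1 :+ (:1 :- :2 :* p) :* R) refl p (r ^ k)))

    -- The second difference is p q^x (1 - q)², that is p³ q^x.
    geometric-convex : Convex (λ x → p * q ^ x)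
    geometric-convex x = 0≤y-x⇒x≤y (≤.trans (*-nonneg (*-nonneg 0≤p (^-nonneg 0≤q x)) (*-nonneg 0≤p 0≤p)) (≤.reflexive
      (solve 2 (λ p Q → let q = :1 :- p in
        (p :* Q) :* (p :* p) := (p :* Q :+ p :* (q :* (q :* Q))) :- (p :* (q :* Q) :+ p :* (q :* Q))) refl p (q ^ x))))

    -- The second difference is p³ q^x (1 - r^(m x - 2)) where m x ≥ 2.  Once m
    -- vanishes so does the function, and its values are nonnegative, so
    -- truncating m at 0 preserves convexity.
    truncated-convex : ∀ {m : ℕ → ℕ} → (∀ x → m (suc x) ≡ ℕ.pred (m x)) → Convex (λ x → p * (q ^ x * (1# - r ^ m x)))
    truncated-convex {m} m-step x with m x | m (1 ℕ.+ x) | m (2 ℕ.+ x) | m-step x | m-step (suc x)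
    ... | zero | _ | _ | ≡.refl | ≡.refl = ≤.reflexive
      (solve 2 (λ p Q → let q = :1 :- p ; f = λ Q → p :* (Q :* (:1 :- :1)) in
        f (q :* Q) :+ f (q :* Q) := f Q :+ f (q :* (q :* Q))) refl p (q ^ x))
    -- Only the value at `x` survives, and 1 - r = 2p, so the second difference is 2p² q^x.
    ... | suc zero | _ | _ | ≡.refl | ≡.refl = 0≤y-x⇒x≤y (≤.trans (*-nonneg (*-nonneg 0≤p (^-nonneg 0≤q x)) (+-nonneg 0≤p 0≤p)) (≤.reflexive
      (solve 2 (λ p Q → let q = :1 :- p
                            r = :1 :- :2 :* p
                            f = λ Q → p :* (Q :* (:1 :- :1)) in
        (p :* Q) :* (p :+ p) := (p :* (Q :* (:1 :- r :* :1)) :+ f (q :* (q :* Q))) :- (f (q :* Q) :+ f (q :* Q))) refl p (q ^ x))))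
    ... | suc (suc k) | _ | _ | ≡.refl | ≡.refl = 0≤y-x⇒x≤y (≤.trans
      (*-nonneg (*-nonneg (*-nonneg 0≤p (^-nonneg 0≤q x)) (*-nonneg 0≤p 0≤p)) (proj₁ (1±r^k-nonneg k))) (≤.reflexive
      (solve 3 (λ p Q R → let q = :1 :- p
                              r = :1 :- :2 :* p
                              f = λ Q R → p :* (Q :* (:1 :- R)) in
        ((p :* Q) :* (p :* p)) :* (:1 :- R) :=
          (f Q (r :* (r :* R)) :+ f (q :* (q :* Q)) R) :- (f (q :* Q) (r :* R) :+ f (q :* Q) (r :* R))) refl p (q ^ x) (r ^ k))))

    -- Abstract, so that unification can read off n from E {n} X.
    abstract
      E : ∀ {n} → (Vec Demand n → Carrier) → Carrier
      E = 𝔼 F p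

      E-suc : ∀ {n} (X : Vec Demand (suc n) → Carrier) → E X ≈ p * E (X ∘ (half ∷_)) + q * E (X ∘ (full ∷_))
      E-suc {n} X = begin
        E X ≡⟨⟩
        ∑L (map (half ∷_) os ++ map (full ∷_) os ++ [])   ≈⟨ ∑L-++ (map (half ∷_) os) ⟩
        ∑L (map (half ∷_) os) + ∑L (map (full ∷_) os ++ []) ≈⟨ +-cong (∑L-∷ half os) (trans (reflexive (≡.cong ∑L (++-identityʳ (map (full ∷_) os)))) (∑L-∷ full os)) ⟩
        p * E (X ∘ (half ∷_)) + q * E (X ∘ (full ∷_)) ∎
        where
        open ≈-Reasoning
        os : List (Vec Demand n)
        os = outcomes n
        ∑L : List (Vec Demand (suc n)) → Carrier
        ∑L Ds = foldr _+_ 0# (map (λ D → Pr F p D * X D) Ds)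
        ∑L-++ : ∀ Ds {Ds′} → ∑L (Ds ++ Ds′) ≈ ∑L Ds + ∑L Ds′
        ∑L-++ []       = sym (+-identityˡ _)
        ∑L-++ (D ∷ Ds) = trans (+-congˡ (∑L-++ Ds)) (sym (+-assoc _ _ _))
        ∑L-∷ : ∀ δ Ds → ∑L (map (δ ∷_) Ds) ≈ Pr₁ F p δ * foldr _+_ 0# (map (λ D → Pr F p D * X (δ ∷ D)) Ds)
        ∑L-∷ δ []       = sym (zeroʳ _)
        ∑L-∷ δ (D ∷ Ds) = trans (+-cong (*-assoc _ _ _) (∑L-∷ δ Ds)) (sym (distribˡ _ _ _))

      E-[] : (X : Vec Demand 0 → Carrier) → E X ≈ X []
      E-[] X = trans (+-identityʳ _) (*-identityˡ _)

      E≈𝔼 : ∀ {n} (X : Vec Demand n → Carrier) → E X ≈ 𝔼 F p X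
      E≈𝔼 X = refl

    E-mono-≤ : ∀ {n} {X Y : Vec Demand n → Carrier} → (∀ D → X D ≤ Y D) → E X ≤ E Y
    E-mono-≤ {zero} {X} {Y} X≤Y = ≤.trans (≤.reflexive (E-[] X)) (≤.trans (X≤Y []) (≤.reflexive (sym (E-[] Y))))
    E-mono-≤ {suc n} {X} {Y} X≤Y = begin
      E X                                              ≈⟨ E-suc X ⟩
      p * E (X ∘ (half ∷_)) + q * E (X ∘ (full ∷_))    ≤⟨ +-mono-≤ (*-monoʳ-≤ 0≤p (E-mono-≤ (X≤Y ∘ (half ∷_)))) (*-monoʳ-≤ 0≤q (E-mono-≤ (X≤Y ∘ (full ∷_)))) ⟩
      p * E (Y ∘ (half ∷_)) + q * E (Y ∘ (full ∷_))    ≈⟨ E-suc Y ⟨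
      E Y                                              ∎
      where open ≤-Reasoning

    E-cong : ∀ {n} {X Y : Vec Demand n → Carrier} → (∀ D → X D ≈ Y D) → E X ≈ E Y
    E-cong X≈Y = ≤.antisym (E-mono-≤ (≤.reflexive ∘ X≈Y)) (E-mono-≤ (≤.reflexive ∘ sym ∘ X≈Y))

    E-linear : ∀ {n} a b (X Y : Vec Demand n → Carrier) → E (λ D → a * X D + b * Y D) ≈ a * E X + b * E Y
    E-linear {zero}  a b X Y = trans (E-[] _) (sym (+-cong (*-congˡ (E-[] X)) (*-congˡ (E-[] Y))))
    E-linear {suc n} a b X Y = begin
      E (λ D → a * X D + b * Y D)  ≈⟨ E-suc _ ⟩
      p * E (λ D → a * X (half ∷ D) + b * Y (half ∷ D)) + q * E (λ D → a * X (full ∷ D) + b * Y (full ∷ D))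
        ≈⟨ +-cong (*-congˡ (E-linear a b _ _)) (*-congˡ (E-linear a b _ _)) ⟩
      p * (a * E (X ∘ (half ∷_)) + b * E (Y ∘ (half ∷_))) + q * (a * E (X ∘ (full ∷_)) + b * E (Y ∘ (full ∷_)))
        ≈⟨ solve 8 (λ p q a b x y x′ y′ → p :* (a :* x :+ b :* y) :+ q :* (a :* x′ :+ b :* y′) :=
             a :* (p :* x :+ q :* x′) :+ b :* (p :* y :+ q :* y′)) refl p q a b _ _ _ _ ⟩
      a * (p * E (X ∘ (half ∷_)) + q * E (X ∘ (full ∷_))) + b * (p * E (Y ∘ (half ∷_)) + q * E (Y ∘ (full ∷_)))
        ≈⟨ +-cong (*-congˡ (E-suc X)) (*-congˡ (E-suc Y)) ⟨
      a * E X + b * E Y ∎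
      where open ≈-Reasoning

    E-0 : ∀ {n} → E {n} (λ _ → 0#) ≈ 0#
    E-0 {n} = trans (E-cong {n} (λ _ → sym (solve 0 (:0 :* :0 :+ :0 :* :0 := :0) refl)))
      (trans (E-linear {n} 0# 0# (λ _ → 0#) (λ _ → 0#)) (trans (+-cong (zeroˡ _) (zeroˡ _)) (+-identityˡ 0#)))

    E-∑ : ∀ {n k} (X : Fin k → Vec Demand n → Carrier) → E (λ D → ∑ (λ i → X i D)) ≈ ∑ (λ i → E (X i))
    E-∑ {n} {zero}  X = E-0 {n}
    E-∑ {n} {suc k} X = begin
      E (λ D → X zero D + ∑ (λ i → X (suc i) D))             ≈⟨ E-cong (λ D → +-cong (*-identityˡ _) (*-identityˡ _)) ⟨
      E (λ D → 1# * X zero D + 1# * ∑ (λ i → X (suc i) D))   ≈⟨ E-linear 1# 1# _ _ ⟩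
      1# * E (X zero) + 1# * E (λ D → ∑ (λ i → X (suc i) D)) ≈⟨ +-cong (*-identityˡ _) (trans (*-identityˡ _) (E-∑ (X ∘ suc))) ⟩
      E (X zero) + ∑ (λ i → E (X (suc i)))                   ∎
      where open ≈-Reasoning

    -- Independence, by peeling off one vertex at a time: the remaining product `R` does not involve
    -- its demand, so its factor leaves the expectation.
    E-∏ : ∀ {n} (g : Fin n → Demand → Carrier) → E (λ D → ∏ (λ j → g j (lookup D j))) ≈ ∏ (λ j → p * g j half + q * g j full)
    E-∏ {zero}  g = E-[] _
    E-∏ {suc n} g = begin
      E (λ D → ∏ (λ j → g j (lookup D j)))   ≈⟨ E-suc (λ D → ∏ (λ j → g j (lookup D j))) ⟩
      p * E (λ D → g zero half * R D) + q * E (λ D → g zero full * R D) ≈⟨ +-cong (*-congˡ (scale (g zero half))) (*-congˡ (scale (g zero full))) ⟩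
      p * (g zero half * E R) + q * (g zero full * E R) ≈⟨ solve 5 (λ p q a b e → p :* (a :* e) :+ q :* (b :* e) := (p :* a :+ q :* b) :* e) refl p q _ _ _ ⟩
      (p * g zero half + q * g zero full) * E R ≈⟨ *-congˡ (E-∏ (g ∘ suc)) ⟩
      (p * g zero half + q * g zero full) * ∏ (λ j → p * g (suc j) half + q * g (suc j) full) ∎
      where
      open ≈-Reasoning
      R : Vec Demand n → Carrier
      R D = ∏ (λ j → g (suc j) (lookup D j))
      scale : ∀ a → E (λ D → a * R D) ≈ a * E R
      scale a = trans (E-cong (λ D → sym (trans (+-congˡ (zeroˡ (R D))) (+-identityʳ _)))) (trans (E-linear a 0# R R) (trans (+-congˡ (zeroˡ _)) (+-identityʳ _)))

    p*1+q*1≈1 : p * 1# + q * 1# ≈ 1#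
    p*1+q*1≈1 = solve 1 (λ p → p :* :1 :+ (:1 :- p) :* :1 := :1) refl p

    p*-1+q*1≈r : p * - 1# + q * 1# ≈ r
    p*-1+q*1≈r = solve 1 (λ p → p :* (:- :1) :+ (:1 :- p) :* :1 :=
      :1 :- :2 :* p) refl p

    E-1 : ∀ n → E {n} (λ _ → 1#) ≈ 1#
    E-1 zero    = E-[] _
    E-1 (suc n) = trans (E-suc _) (trans (+-cong (*-congˡ (E-1 n)) (*-congˡ (E-1 n))) p*1+q*1≈1)

    weight : Carrier → Demand → Carrier
    weight v δ = if does (half? δ) then v else 1#

    -- The weight v^|S| of a generating function: v = -1 gives the parity sign, v = 1 the constant
    -- 1.
    χ : ∀ {n} → Carrier → Vec Demand n → Carrier
    χ v D = v ^ length (halves D)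

    χ≈∏weight : ∀ {n} v (D : Vec Demand n) → χ v D ≈ ∏ (λ j → weight v (lookup D j))
    χ≈∏weight v D = sym (sum-if *-monoid (λ j → half? (lookup D j)) v id)

    ∏-const : ∀ n x → ∏ {n} (λ _ → x) ≈ x ^ n
    ∏-const zero    x = refl
    ∏-const (suc n) x = *-congˡ (∏-const n x)

    E-χ : ∀ n v → E (χ {n} v) ≈ (p * v + q * 1#) ^ n
    E-χ n v = begin
      E (χ v)                                            ≈⟨ E-cong (χ≈∏weight v) ⟩
      E (λ D → ∏ (λ j → weight v (lookup D j)))          ≈⟨ E-∏ {n} (λ _ → weight v) ⟩
      ∏ {n} (λ _ → p * v + q * 1#)                       ≈⟨ ∏-const n _ ⟩
      (p * v + q * 1#) ^ n                               ∎
      where open ≈-Reasoning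

    module _ {n} (G : SimpleGraph n) where

      -- Vertex by vertex: `i` must lie in the support and gives `p * v`, each neighbour must lie
      -- outside and gives `q`, and each remote vertex is free and gives `p * v + q * 1#`.
      E-isolated-χ : ∀ v i → E (λ D → 𝟙 (isolated? G D i) * χ v D) ≈
        (p * v) * (q ^ degree G i * (p * v + q * 1#) ^ (n ∸ degree G i ∸ 1))
      E-isolated-χ v i = begin
        E (λ D → 𝟙 (isolated? G D i) * χ v D)
          ≈⟨ E-cong (λ D → trans (*-cong (sym (∏-𝟙 (λ j → compatible? G i j (lookup D j)) (isolated? G D i) id id)) (χ≈∏weight v D)) (sym (∏-distrib-* (λ j → 𝟙 (compatible? G i j (lookup D j))) (λ j → weight v (lookup D j))))) ⟩
        E (λ D → ∏ (λ j → g j (lookup D j)))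
          ≈⟨ E-∏ g ⟩
        ∏ (λ j → p * g j half + q * g j full)
          ≈⟨ ∏-cong factor ⟩
        ∏ (λ j → self j * (nbr j * far j))
          ≈⟨ trans (∏-distrib-* self (λ j → nbr j * far j)) (*-congˡ (∏-distrib-* nbr far)) ⟩
        ∏ self * (∏ nbr * ∏ far)
          ≈⟨ *-cong (trans (sum-if *-monoid (i ≟_) (p * v) id) (trans (reflexive (≡.cong ((p * v) ^_) (length-self G i))) (*-identityʳ _)))
              (*-cong (sum-if *-monoid (Graph.adj? G i) q id)
                (trans (sum-if *-monoid (remote? G i) w id) (reflexive (≡.cong (w ^_) (length-remote G i))))) ⟩
        (p * v) * (q ^ degree G i * w ^ (n ∸ degree G i ∸ 1)) ∎
        where
        open ≈-Reasoning
        w = p * v + q * 1#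
        g : Fin n → Demand → Carrier
        g j δ = 𝟙 (compatible? G i j δ) * weight v δ
        self nbr far : Fin n → Carrier
        self j = if does (i ≟ j) then p * v else 1#
        nbr j  = if does (Graph.adj? G i j) then q else 1#
        far j  = if does (remote? G i j) then w else 1#
        factor : ∀ j → p * g j half + q * g j full ≈ self j * (nbr j * far j)
        factor j with i ≟ j | Graph.adj? G i j
        ... | yes i≡j | yes ij = contradiction ij (Graph.irrefl G i≡j)
        ... | yes _   | no _   = solve 3 (λ p q v → p :* (:1 :* v) :+ q :* (:0 :* :1) := (p :* v) :* (:1 :* :1)) refl p q v
        ... | no _    | yes _  = solve 3 (λ p q v → p :* (:0 :* v) :+ q :* (:1 :* :1) := :1 :* (q :* :1)) refl p q v
        ... | no _    | no _   = solve 3 (λ p q v → p :* (:1 :* v) :+ q :* (:1 :* :1) := :1 :* (:1 :* (p :* v :+ q :* :1))) refl p q v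

      ∑-isolated : ∀ D → ∑ (λ i → 𝟙 (isolated? G D i)) ≈ fromℕ (length (isolated G D))
      ∑-isolated D = sum-if +-monoid (isolated? G D) 1# id

      private
        I : Vec Demand n → Carrier
        I D = fromℕ (length (isolated G D))
        L : Vec Demand n → Carrier
        L = matchingLoss F G

      -- The matching counts are compared additively in ℕ and subtracted only after the passage to
      -- scalars. The slack `j` is the parity defect, 0 or 1.
      gap⇒≤L : ∀ D k j → let μG = μ (induced G (supp D)) ; μK = μ (induced (complete n) (supp D)) in
        (μG ℕ.+ μG) ℕ.+ k ℕ.≤ j ℕ.+ (μK ℕ.+ μK) → fromℕ k ≤ fromℕ j + L D
      gap⇒≤L D k j gap = begin
        fromℕ k                                  ≈⟨ solve 2 (λ g k → k := ((g :+ g) :+ k) :- (g :+ g)) refl g (fromℕ k) ⟩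
        ((g + g) + fromℕ k) - (g + g)            ≈⟨ +-congʳ (trans (×-homo-+ 1# (μG ℕ.+ μG) k) (+-congʳ (×-homo-+ 1# μG μG))) ⟨
        fromℕ ((μG ℕ.+ μG) ℕ.+ k) - (g + g)      ≤⟨ +-monoˡ-≤ _ (fromℕ-mono-≤ gap) ⟩
        fromℕ (j ℕ.+ (μK ℕ.+ μK)) - (g + g)      ≈⟨ +-congʳ (trans (×-homo-+ 1# j (μK ℕ.+ μK)) (+-congˡ (×-homo-+ 1# μK μK))) ⟩
        (fromℕ j + (h + h)) - (g + g)            ≈⟨ solve 3 (λ g h j → (j :+ (h :+ h)) :- (g :+ g) := j :+ :2 :* (h :- g)) refl g h (fromℕ j) ⟩
        fromℕ j + L D                            ∎
        where
        open ≤-Reasoning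
        μG = μ (induced G (supp D))
        μK = μ (induced (complete n) (supp D))
        g = fromℕ μG
        h = fromℕ μK

      -- The term ½ (1 - (-1)^|S|) is the indicator that |S| is odd. The factors `1#` and `- 1#`
      -- stay visible so that the right side has the shape of `E-linear`.
      I≤L+[odd] : ∀ D → I D ≤ 1# * L D + ½ * (1# * 1# + - 1# * χ (- 1#) D)
      I≤L+[odd] D with parity (length (halves D)) in eq
      ... | 0ℙ = ≤.trans (gap⇒≤L D _ 0 (isolated-gap-even G D eq)) (≤.reflexive (begin
        0# + L D                                     ≈⟨ solve 2 (λ l h → :0 :+ l := :1 :* l :+ h :* (:1 :* :1 :+ (:- :1) :* :1)) refl (L D) ½ ⟩
        1# * L D + ½ * (1# * 1# + - 1# * 1#)         ≈⟨ +-congˡ (*-congˡ (+-congˡ (*-congˡ (-1^even (length (halves D)) eq)))) ⟨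
        1# * L D + ½ * (1# * 1# + - 1# * χ (- 1#) D) ∎))
        where open ≈-Reasoning
      ... | 1ℙ = ≤.trans (gap⇒≤L D _ 1 (isolated-gap-odd G D eq)) (≤.reflexive (begin
        (1# + 0#) + L D                              ≈⟨ +-congʳ (trans (+-identityʳ 1#) (sym ½+½≈1)) ⟩
        (½ + ½) + L D                                ≈⟨ solve 2 (λ l h → (h :+ h) :+ l := :1 :* l :+ h :* (:1 :* :1 :+ (:- :1) :* (:- :1))) refl (L D) ½ ⟩
        1# * L D + ½ * (1# * 1# + - 1# * - 1#)       ≈⟨ +-congˡ (*-congˡ (+-congˡ (*-congˡ (-1^odd (length (halves D)) eq)))) ⟨
        1# * L D + ½ * (1# * 1# + - 1# * χ (- 1#) D) ∎))
        where open ≈-Reasoning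

      -- The factor ½ (1 + (-1)^|S|) indicates that |S| is even; it is multiplied out for
      -- `E-linear`. For odd |S| the left side vanishes and nonnegativity of the loss remains.
      I*[even]≤L : ∀ D → ½ * I D + ½ * (I D * χ (- 1#) D) ≤ L D
      I*[even]≤L D with parity (length (halves D)) in eq
      ... | 0ℙ = ≤.trans (≤.reflexive (begin
        ½ * I D + ½ * (I D * χ (- 1#) D)  ≈⟨ +-congˡ (*-congˡ (*-congˡ (-1^even (length (halves D)) eq))) ⟩
        ½ * I D + ½ * (I D * 1#)          ≈⟨ solve 2 (λ i h → h :* i :+ h :* (i :* :1) := (h :+ h) :* i) refl (I D) ½ ⟩
        (½ + ½) * I D                     ≈⟨ trans (*-congʳ ½+½≈1) (*-identityˡ _) ⟩
        I D                               ∎))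
        (≤.trans (gap⇒≤L D _ 0 (isolated-gap-even G D eq)) (≤.reflexive (+-identityˡ _)))
        where open ≈-Reasoning
      ... | 1ℙ = ≤.trans (≤.reflexive (begin
        ½ * I D + ½ * (I D * χ (- 1#) D)  ≈⟨ +-congˡ (*-congˡ (*-congˡ (-1^odd (length (halves D)) eq))) ⟩
        ½ * I D + ½ * (I D * - 1#)        ≈⟨ solve 2 (λ i h → h :* i :+ h :* (i :* (:- :1)) := :0) refl (I D) ½ ⟩
        0#                                ∎))
        (≤.trans (gap⇒≤L D 0 0 (ℕ.≤-trans (ℕ.≤-reflexive (ℕ.+-identityʳ _)) (μ-gap G D))) (≤.reflexive (+-identityˡ _)))
        where open ≈-Reasoning

      E-I : E I ≈ ∑ (λ i → p * q ^ degree G i)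
      E-I = begin
        E I                                                ≈⟨ E-cong (λ D → sym (∑-isolated D)) ⟩
        E (λ D → ∑ (λ i → 𝟙 (isolated? G D i)))            ≈⟨ E-∑ (λ i D → 𝟙 (isolated? G D i)) ⟩
        -- The trivial weight `χ 1# D` is inserted to reach the case v = 1 of `E-isolated-χ`.
        ∑ (λ i → E (λ D → 𝟙 (isolated? G D i)))            ≈⟨ sum-cong-≋ {n} (λ i → E-cong {n} (λ D → sym (trans (*-congˡ (1^ (length (halves D)))) (*-identityʳ _)))) ⟩
        ∑ (λ i → E (λ D → 𝟙 (isolated? G D i) * χ 1# D))   ≈⟨ sum-cong-≋ {n} (λ i → trans (E-isolated-χ 1# i) (simplify (degree G i) (n ∸ degree G i ∸ 1))) ⟩
        ∑ (λ i → p * q ^ degree G i)                       ∎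
        where
        open ≈-Reasoning
        simplify : ∀ e m → (p * 1#) * (q ^ e * (p * 1# + q * 1#) ^ m) ≈ p * q ^ e
        simplify e m = trans (*-congˡ (*-congˡ (trans (^-congˡ m p*1+q*1≈1) (1^ m)))) (*-cong (*-identityʳ p) (*-identityʳ _))

      -- The minus sign comes from `i` itself, which lies in the support and contributes `p * - 1#`;
      -- each remote vertex contributes `r`.
      E-Iχ : E (λ D → I D * χ (- 1#) D) ≈ ∑ (λ i → p * (q ^ degree G i * - (r ^ (n ∸ degree G i ∸ 1))))
      E-Iχ = begin
        E (λ D → I D * χ (- 1#) D)                             ≈⟨ E-cong (λ D → trans (*-congʳ (sym (∑-isolated D))) (*-distribʳ-sum (χ (- 1#) D) (λ i → 𝟙 (isolated? G D i)))) ⟩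
        E (λ D → ∑ (λ i → 𝟙 (isolated? G D i) * χ (- 1#) D))   ≈⟨ E-∑ (λ i D → 𝟙 (isolated? G D i) * χ (- 1#) D) ⟩
        ∑ (λ i → E (λ D → 𝟙 (isolated? G D i) * χ (- 1#) D))   ≈⟨ sum-cong-≋ {n} (λ i → trans (E-isolated-χ (- 1#) i) (simplify (q ^ degree G i) (n ∸ degree G i ∸ 1))) ⟩
        ∑ (λ i → p * (q ^ degree G i * - (r ^ (n ∸ degree G i ∸ 1)))) ∎
        where
        open ≈-Reasoning
        simplify : ∀ Q m → (p * - 1#) * (Q * (p * - 1# + q * 1#) ^ m) ≈ p * (Q * - (r ^ m))
        simplify Q m = trans (*-congˡ (*-congˡ (^-congˡ m p*-1+q*1≈r)))
          (solve 3 (λ p Q R → (p :* (:- :1)) :* (Q :* R) := p :* (Q :* (:- R))) refl p Q (r ^ m))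

      module _ (d : ℕ) (∑deg : sum (map (degree G) (allFin n)) ≡ n ℕ.* d) where

        private
          mean : ∑ (λ i → fromℕ (degree G i)) ≈ fromℕ (n ℕ.* d)
          mean = trans (sym (fromℕ-sum (degree G) id)) (reflexive (≡.cong fromℕ ∑deg))

        bound₁ : fromℕ n * p * q ^ d - ½ * (1# - r ^ n) ≤ 𝔼 F p L
        bound₁ = begin
          fromℕ n * p * q ^ d - t                        ≈⟨ +-congʳ (*-assoc _ _ _) ⟩
          fromℕ n * (p * q ^ d) - t                      ≤⟨ +-monoˡ-≤ _ (jensen geometric-convex d (degree G) mean) ⟩
          ∑ (λ i → p * q ^ degree G i) - t               ≈⟨ +-congʳ E-I ⟨
          E I - t                                        ≤⟨ +-monoˡ-≤ _ (E-mono-≤ I≤L+[odd]) ⟩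
          -- The parity sign has expectation `r ^ n`, so the odd correction has expectation exactly
          -- `t` and cancels.
          E (λ D → 1# * L D + ½ * (1# * 1# + - 1# * χ (- 1#) D)) - t
            ≈⟨ +-congʳ (trans (E-linear 1# ½ L _) (+-congˡ (*-congˡ (trans (E-linear {n} 1# (- 1#) (λ _ → 1#) (χ (- 1#))) (+-cong (*-congˡ (E-1 n)) (*-congˡ (trans (E-χ n (- 1#)) (^-congˡ n p*-1+q*1≈r)))))))) ⟩
          (1# * E L + ½ * (1# * 1# + - 1# * r ^ n)) - t
            ≈⟨ solve 3 (λ e h R → (:1 :* e :+ h :* (:1 :* :1 :+ (:- :1) :* R)) :- h :* (:1 :- R) := e) refl (E L) ½ (r ^ n) ⟩
          E L                                            ≈⟨ E≈𝔼 L ⟩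
          𝔼 F p L                                        ∎
          where
          open ≤-Reasoning
          t = ½ * (1# - r ^ n)

        bound₂ : ½ * (fromℕ n * p * q ^ d) * (1# - r ^ (n ∸ d ∸ 1)) ≤ 𝔼 F p L
        bound₂ = begin
          ½ * (fromℕ n * p * q ^ d) * (1# - R d)
            ≈⟨ solve 5 (λ h n p Q S → h :* (n :* p :* Q) :* S := h :* (n :* (p :* (Q :* S)))) refl ½ (fromℕ n) p (q ^ d) (1# - R d) ⟩
          -- Jensen precedes the splitting of `1# - R`: the part with `- R` need not be convex on
          -- its own.
          ½ * (fromℕ n * (p * (q ^ d * (1# - R d))))
            ≤⟨ *-monoʳ-≤ 0≤½ (jensen (truncated-convex {λ x → n ∸ x ∸ 1} m-step) d (degree G) mean) ⟩
          ½ * ∑ (λ i → p * (q ^ degree G i * (1# - R (degree G i))))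
            ≈⟨ *-congˡ (sum-cong-≋ {n} (λ i → solve 3 (λ p Q R → p :* (Q :* (:1 :- R)) := p :* Q :+ p :* (Q :* (:- R))) refl p (q ^ degree G i) (R (degree G i)))) ⟩
          ½ * ∑ (λ i → p * q ^ degree G i + p * (q ^ degree G i * - R (degree G i)))
            ≈⟨ *-congˡ (trans (∑-distrib-+ (λ i → p * q ^ degree G i) _) (+-cong (sym E-I) (sym E-Iχ))) ⟩
          ½ * (E I + E (λ D → I D * χ (- 1#) D))
            ≈⟨ trans (distribˡ ½ _ _) (sym (E-linear ½ ½ I _)) ⟩
          E (λ D → ½ * I D + ½ * (I D * χ (- 1#) D))
            ≤⟨ E-mono-≤ I*[even]≤L ⟩
          E L ≈⟨ E≈𝔼 L ⟩
          𝔼 F p L ∎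
          where
          open ≤-Reasoning
          R : ℕ → Carrier
          R x = r ^ (n ∸ x ∸ 1)
          -- The exponent drops by one at each step and then stays at 0, as `truncated-convex`
          -- requires.
          m-step : ∀ x → n ∸ suc x ∸ 1 ≡ ℕ.pred (n ∸ x ∸ 1)
          m-step x = ≡.trans (≡.cong (_∸ 1) (≡.sym (ℕ.pred[m∸n]≡m∸[1+n] n x))) (pred-comm (n ∸ x))
            where
            pred-comm : ∀ k → ℕ.pred k ∸ 1 ≡ ℕ.pred (k ∸ 1)
            pred-comm zero          = ≡.refl
            pred-comm (suc zero)    = ≡.refl
            pred-comm (suc (suc k)) = ≡.refl

theorem4p1 : ∀ {c ℓ₁ ℓ₂ ℓ₃} (F : OrderedField c ℓ₁ ℓ₂ ℓ₃) →
    let open OrderedField F in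
    (p : Carrier) → 0# < p → p < 1# →
    (n : ℕ) .{{_ : NonZero n}} (G : SimpleGraph n) →
    (d : ℕ) → averageDegree G ≃ (+ d) / 1 →
    let q = 1# - p in
    expectedMatchingLoss F p G ≥
    (fromℕ n * p * q ^ d - ½ * (1# - (1# - fromℕ 2 * p) ^ n))
    ⊔ (½ * (fromℕ n * p * q ^ d) * (1# - (1# - fromℕ 2 * p) ^ (n ∸ d ∸ 1)))
theorem4p1 F p 0<p p<1 n G d avg = IsLattice.∨-least isLattice (bound₁ p 0<p p<1 G d ∑deg) (bound₂ p 0<p p<1 G d ∑deg)
  where
  open OrderedField F using (isLattice)
  open ExpectedLoss F
  ∑deg = ∑-degree G d avg
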